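{- Let $q$ be a prime power and $m$ a positive integer. If there exists an $[\mathcal F,k,\delta]_{q^m}$ code, where $\mathcal F=[\gamma_0,\gamma_1,\ldots,\gamma_{n-1}]$ is a Ferrers diagram, then there exists an $[\mathcal F',mk,m\delta]_q$ code, where $$\mathcal F'=[\underbrace{m\gamma_0,\ldots,m\gamma_0}_{m},\underbrace{m\gamma_1,\ldots,m\gamma_1}_{m},\ldots,\underbrace{m\gamma_{n-1},\ldots,m\gamma_{n-1}}_{m}].$$
   Context: Ferrers diagrams. For positive integers $a,n$, an $a\times n$ Ferrers diagram is an $a\times n$ array of dots and empty cells such that all dots are shifted to the right, the number of dots in each row is at most the number of dots in the previous row, the first row has $n$ dots and the rightmost column has $a$ dots. It is identified with its column cardinalities: $\mathcal F=[\gamma_0,\gamma_1,\ldots,\gamma_{n-1}]$ with $1\leq\gamma_0\leq\gamma_1\leq\cdots\leq\gamma_{n-1}=a$, where the $(j+1)$-th column from the left has exactly $\gamma_j$ dots, located in its top $\gamma_j$ cells. Codes. For an $a\times n$ Ferrers diagram $\mathcal F$ and a prime power $Q$, an $[\mathcal F,k,\delta]_Q$ code (Ferrers diagram rank-metric code) is a $k$-dimensional $\mathbb F_Q$-linear subspace of $\mathbb F_Q^{a\times n}$ with minimum rank distance $\delta$ (the minimum of the ranks over $\mathbb F_Q$ of its nonzero matrices), such that in every matrix of the code all entries at positions not in $\mathcal F$ are zero. -}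

module Defs where

open import Algebra.Bundles using (CommutativeRing)
import Algebra.Properties.CommutativeMonoid.Sum as Sum
open import Data.Fin.Base as Fin using (Fin; toℕ; quotient; remainder; combine)
open import Data.Fin.Properties using (toℕ<n; toℕ-combine; combine-remQuot; combine-monoˡ-<)
open import Data.Nat.Base using (ℕ; suc; _+_; _*_; _^_; _≤_; _<_; NonZero; >-nonZero⁻¹)
open import Data.Nat.Primality using (Prime)
open import Data.Nat.Properties
open import Data.Product.Base using (∃; ∃-syntax; _×_; _,_)
open import Function.Bundles using (Inverse)
open import Level using (_⊔_) renaming (suc to lsuc)
open import Relation.Binary.PropositionalEquality
  using (_≡_; cong; subst₂; setoid)
open import Relation.Nullary using (¬_)
open import Relation.Unary using (Pred; _∈_; _⊆_)

IsPrimePower : ℕ → Set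
IsPrimePower q = ∃[ p ] ∃[ e ] Prime p × 1 ≤ e × q ≡ p ^ e

-- A Ferrers diagram with a rows and n columns, given by its column
-- cardinalities: the dots of column j are the cells (i , j) with toℕ i < γ j.
record FerrersDiagram (a n : ℕ) : Set where
  field
    γ         : Fin n → ℕ
    0<n       : 0 < n
    γ-pos     : ∀ j → 1 ≤ γ j
    γ-mono    : ∀ {i j} → i Fin.≤ j → γ i ≤ γ j
    γ-last    : ∀ j → suc (toℕ j) ≡ n → γ j ≡ a

open FerrersDiagram public

private
  combine-quotient : ∀ {n} m (j : Fin (n * m)) →
                     combine (quotient {n} m j) (remainder {n} m j) ≡ j
  combine-quotient {n} m j = combine-remQuot {n} m j

  quotient-mono : ∀ {n} m {i j : Fin (n * m)} → i Fin.≤ j →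
                  quotient {n} m i Fin.≤ quotient {n} m j
  quotient-mono {n} m {i} {j} i≤j = ≮⇒≥ λ qj<qi →
    <⇒≱ (subst₂ Fin._<_ (combine-quotient {n} m j) (combine-quotient {n} m i)
           (combine-monoˡ-< (remainder {n} m j) (remainder {n} m i) qj<qi))
        i≤j

  quotient-last : ∀ {n} m .{{_ : NonZero m}} (j : Fin (n * m)) →
                  suc (toℕ j) ≡ n * m → suc (toℕ (quotient {n} m j)) ≡ n
  quotient-last {n} m j last = ≤-antisym (toℕ<n Q) (*-cancelʳ-≤ n (suc (toℕ Q)) m (begin
    n * m                  ≡⟨ last ⟨
    suc (toℕ j)            ≡⟨ cong (λ k → suc (toℕ k)) (combine-quotient {n} m j) ⟨
    suc (toℕ (combine Q R)) ≡⟨ cong suc (toℕ-combine Q R) ⟩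
    suc (m * toℕ Q + toℕ R) ≡⟨ +-suc (m * toℕ Q) (toℕ R) ⟨
    m * toℕ Q + suc (toℕ R) ≤⟨ +-monoʳ-≤ (m * toℕ Q) (toℕ<n R) ⟩
    m * toℕ Q + m           ≡⟨ +-comm (m * toℕ Q) m ⟩
    m + m * toℕ Q           ≡⟨ *-suc m (toℕ Q) ⟨
    m * suc (toℕ Q)         ≡⟨ *-comm m (suc (toℕ Q)) ⟩
    suc (toℕ Q) * m         ∎))
    where
    open ≤-Reasoning
    Q = quotient {n} m j
    R = remainder {n} m j

-- [ mγ₀ , … , mγ₀ , mγ₁ , … , mγ₁ , … ], each value repeated m times
-- (quotient m j is the integer quotient of the index j by m).
dilate : ∀ {a n} m .{{_ : NonZero m}} → FerrersDiagram a n → FerrersDiagram (m * a) (n * m)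
dilate {a} {n} m F = record
  { γ      = λ j → m * γ F (quotient {n} m j)
  ; 0<n    = *-mono-≤ (0<n F) (>-nonZero⁻¹ m)
  ; γ-pos  = λ j → *-mono-≤ (>-nonZero⁻¹ m) (γ-pos F (quotient {n} m j))
  ; γ-mono = λ i≤j → *-monoʳ-≤ m (γ-mono F (quotient-mono {n} m i≤j))
  ; γ-last = λ j last → cong (m *_) (γ-last F (quotient {n} m j) (quotient-last {n} m j last))
  }

record FiniteField c ℓ (q : ℕ) : Set (lsuc (c ⊔ ℓ)) where
  field
    commutativeRing : CommutativeRing c ℓ
  open CommutativeRing commutativeRing public
    hiding (_+_; _*_) renaming (setoid to ≈-setoid)
  open CommutativeRing commutativeRing public
    using () renaming (_+_ to _⊕_; _*_ to _⊗_)
  field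
    0≉1         : ¬ 0# ≈ 1#
    inverse     : ∀ x → ¬ x ≈ 0# → ∃[ y ] x ⊗ y ≈ 1#
    enumeration : Inverse ≈-setoid (setoid (Fin q))

module _ {c ℓ q} (K : FiniteField c ℓ q) where
  open FiniteField K
  open Sum +-commutativeMonoid using (sum)

  -- The coordinate space K^I; columns of length a have I = Fin a, and
  -- a × n matrices have I = Fin a × Fin n.
  Space : Set → Set c
  Space I = I → Carrier

  Matrix : ℕ → ℕ → Set c
  Matrix a n = Space (Fin a × Fin n)

  module _ {I : Set} where

    SameEntries : Space I → Space I → Set ℓ
    SameEntries u v = ∀ i → u i ≈ v i

    IsZero : Space I → Set ℓ
    IsZero v = ∀ i → v i ≈ 0#

    combination : ∀ {d} → (Fin d → Carrier) → (Fin d → Space I) → Space I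
    combination x v i = sum (λ j → x j ⊗ v j i)

    Span : ∀ {d} → (Fin d → Space I) → Pred (Space I) (c ⊔ ℓ)
    Span v u = ∃[ x ] SameEntries u (combination x v)

    LinearlyIndependent : ∀ {d} → (Fin d → Space I) → Set (c ⊔ ℓ)
    LinearlyIndependent v = ∀ x → IsZero (combination x v) → ∀ j → x j ≈ 0#

    record IsSubspace {p} (V : Pred (Space I) p) : Set (c ⊔ ℓ ⊔ p) where
      field
        respects     : ∀ {u v} → SameEntries u v → u ∈ V → v ∈ V
        zero-closed  : (λ _ → 0#) ∈ V
        +-closed     : ∀ {u v} → u ∈ V → v ∈ V → (λ i → u i ⊕ v i) ∈ V
        scale-closed : ∀ x {v} → v ∈ V → (λ i → x ⊗ v i) ∈ V

    record HasDimension {p} (V : Pred (Space I) p) (d : ℕ) : Set (c ⊔ ℓ ⊔ p) where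
      field
        basis       : Fin d → Space I
        inside      : ∀ j → basis j ∈ V
        independent : LinearlyIndependent basis
        spanning    : V ⊆ Span basis

  ColumnSpace : ∀ {a n} → Matrix a n → Pred (Space (Fin a)) (c ⊔ ℓ)
  ColumnSpace M = Span (λ j i → M (i , j))

  HasRank : ∀ {a n} → Matrix a n → ℕ → Set (c ⊔ ℓ)
  HasRank M r = HasDimension (ColumnSpace M) r

  -- The minimum has to be attained, so a code has a minimum distance only if
  -- it contains a nonzero matrix.
  record HasMinimumDistance {a n p} (C : Pred (Matrix a n) p) (δ : ℕ) : Set (c ⊔ ℓ ⊔ p) where
    field
      attained : ∃[ M ] M ∈ C × ¬ IsZero M × HasRank M δ
      bound    : ∀ {M} → M ∈ C → ¬ IsZero M → ∃[ r ] HasRank M r × δ ≤ r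

  -- C is an [F, k, δ] code over the field K.
  record IsFerrersCode {a n p} (F : FerrersDiagram a n) (k δ : ℕ)
                       (C : Pred (Matrix a n) p) : Set (c ⊔ ℓ ⊔ p) where
    field
      isSubspace      : IsSubspace C
      dimension       : HasDimension C k
      minimumDistance : HasMinimumDistance C δ
      support         : ∀ {M} → M ∈ C → ∀ i j → γ F j ≤ toℕ i → M (i , j) ≈ 0#

  FerrersCode : ∀ {a n} → FerrersDiagram a n → (k δ : ℕ) → Set (lsuc (c ⊔ ℓ))
  FerrersCode {a} {n} F k δ =
    ∃ λ (C : Pred (Matrix a n) (c ⊔ ℓ)) → IsFerrersCode F k δ C

{-# OPTIONS --safe #-}

-- Once K = F_q is embedded into L = F_{q^m}, counting shows that L has a K-basis
-- b_1, …, b_m.  Replacing each entry of a matrix M over L by the m × m matrix of the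
-- multiplication by that entry turns the column space of M into the same space
-- regarded over K, so ranks are multiplied by m, and so is the dimension of a code;
-- an entry outside F becomes a zero block outside F′.
--
-- The embedding is obtained by adjoining the elements of K one at a time to a partial
-- embedding of the prime field.  The minimal polynomial f of α ∈ K over the subring
-- reached so far divides X^(q^m) - X, which vanishes on all of L, whereas the quotient
-- has too small a degree to vanish on L; hence f has a root in L, the image of α.
module Submission where

open import Defs
open import Algebra.Bundles using (CommutativeMonoid; CommutativeRing)
import Algebra.Construct.DirectProduct as DirectProduct
import Algebra.Properties.CommutativeMonoid.Sum as MonoidSum
import Algebra.Properties.CommutativeSemigroup as CommutativeSemigroupProperties
import Algebra.Properties.Monoid.Mult as MonoidMult
import Algebra.Properties.Ring as RingProperties
import Algebra.Properties.Semiring.Exp as Exp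
import Algebra.Properties.Semiring.Mult as Mult
import Algebra.Properties.Semiring.Sum as SemiringSum
import Algebra.Solver.Ring.NaturalCoefficients.Default as SemiringSolver
open import Data.Fin.Base as Fin
  using (Fin; zero; suc; toℕ; cast; combine; remQuot; quotient; remainder; finToFun; funToFin;
         punchIn; _↑ˡ_; _↑ʳ_)
open import Data.Fin.Permutation using (Permutation′; permutation; _⟨$⟩ʳ_)
import Data.Fin.Properties as Fin
open import Data.List.Base as List using (List; []; _∷_)
open import Data.Nat.Base as ℕ using (ℕ; zero; suc; z≤n; s≤s; NonZero)
import Data.Nat.Coprimality as Coprimality
open import Data.Nat.Divisibility using (_∣_; divides; _∣?_)
open import Data.Nat.GCD using (module Bézout)
open import Data.Nat.Induction using (<-rec)
open import Data.Nat.Primality using (Prime; prime⇒irreducible; prime⇒nonZero)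
import Data.Nat.Properties as ℕ
open import Data.Product.Base using (∃; ∃-syntax; ∃₂; _×_; _,_; proj₁; proj₂; uncurry)
open import Data.Sum.Base using (_⊎_; inj₁; inj₂)
open import Data.Vec.Base as Vec using (Vec; []; _∷_)
import Data.Vec.Functional as Vector
open import Data.Vec.Relation.Unary.All using (All; []; _∷_)
open import Function.Base using (_∘_; const)
open import Function.Bundles using (Inverse)
open import Level using (_⊔_) renaming (suc to lsuc; zero to lzero)
open import Relation.Binary.Definitions using (Decidable)
open import Relation.Binary.PropositionalEquality as ≡ using (_≡_)
open import Relation.Nullary using (¬_; Dec; yes; no; contradiction)
open import Relation.Nullary.Decidable using (_×-dec_; decidable-stable; map′)
open import Relation.Unary using (Pred; _∈_)

-- `K` and `L` are arbitrary fields of the given orders with no map between them, so the embedding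
-- is most of the work. In the extension step, polynomials have coefficients in a subring of
-- `K × L`: a single polynomial carries its version over `K` in the first coordinate and the version
-- transported to `L` in the second, so one division identity serves both fields. Minimality of the
-- degree takes the place of irreducibility. For the rank, the columns of the expanded matrix are,
-- in coordinates, the columns of `M` multiplied by the `b_s`; as the `b_s` span `L` over `K`, the
-- `K`-span of these products is the `L`-span of the columns.

module _ {c ℓ} (M : CommutativeMonoid c ℓ) where
  open CommutativeMonoid M
  open MonoidSum M
  open import Relation.Binary.Reasoning.Setoid setoid

  -- Needed multiplicatively in `x^q≈x`, for two products over `K` that differ only at the element
  -- zero.
  sum-replace : ∀ {n} {f g : Fin n → Carrier} {x} i → f i ≈ x → g i ≈ ε →
                (∀ j → ¬ j ≡ i → f j ≈ g j) → sum f ≈ x ∙ sum g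
  sum-replace {suc n} {f} {g} {x} i fi≈x gi≈ε f≈g = begin
    sum f                            ≈⟨ sum-remove {i = i} f ⟩
    f i ∙ sum (f ∘ punchIn i)        ≈⟨ ∙-cong fi≈x (sum-cong-≋ λ j → f≈g _ (Fin.punchInᵢ≢i i j)) ⟩
    x ∙ sum (g ∘ punchIn i)          ≈⟨ ∙-congˡ (trans (∙-congʳ gi≈ε) (identityˡ _)) ⟨
    x ∙ (g i ∙ sum (g ∘ punchIn i))  ≈⟨ ∙-congˡ (sum-remove {i = i} g) ⟨
    x ∙ sum g                        ∎

  sum-++ : ∀ m {n} (f : Fin (m ℕ.+ n) → Carrier) →
           sum f ≈ sum (λ i → f (i ↑ˡ n)) ∙ sum (λ j → f (m ↑ʳ j))
  sum-++ zero    f = sym (identityˡ _)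
  sum-++ (suc m) f = trans (∙-congˡ (sum-++ m (f ∘ suc))) (sym (assoc _ _ _))

  sum-combine : ∀ m n (f : Fin (m ℕ.* n) → Carrier) →
                sum f ≈ sum {m} (λ i → sum {n} (λ j → f (combine i j)))
  sum-combine zero    n f = refl
  sum-combine (suc m) n f = trans (sum-++ n f) (∙-congˡ (sum-combine m n (f ∘ (n ↑ʳ_))))

  sum-ε : ∀ {n} {f : Fin n → Carrier} → (∀ i → f i ≈ ε) → sum f ≈ ε
  sum-ε {n} f≈ε = trans (sum-cong-≋ f≈ε) (sum-replicate-zero n)

-- Finite fields: the sum and the product over all elements.

module FieldProperties {c ℓ q} (K : FiniteField c ℓ q) where
  open FiniteField K public hiding (zero)
  open Inverse enumeration public using ()
    renaming (to to index; from to element; to-cong to index-cong;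
              strictlyInverseˡ to index-element; strictlyInverseʳ to element-index)
  open RingProperties ring public
  open Mult semiring public using () renaming (_×_ to _·_)
  open Exp semiring public using (_^_; ^-congˡ; ^-assocʳ)
  open import Relation.Binary.Reasoning.Setoid ≈-setoid

  index-injective : ∀ {x y} → index x ≡ index y → x ≈ y
  index-injective {x} {y} eq = trans (sym (element-index x))
    (trans (reflexive (≡.cong element eq)) (element-index y))

  _≟_ : Decidable _≈_
  x ≟ y = map′ index-injective index-cong (index x Fin.≟ index y)

  element-injective : ∀ {i j} → element i ≈ element j → i ≡ j
  element-injective {i} {j} eq =
    ≡.trans (≡.sym (index-element i)) (≡.trans (index-cong eq) (index-element j))

  ∃-inverse : ∀ {x} → ¬ x ≈ 0# → ∃[ y ] y ⊗ x ≈ 1#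
  ∃-inverse {x} x≉0 with inverse x x≉0
  ... | y , xy≈1 = y , trans (*-comm y x) xy≈1

  *-cancelˡ-nonZero : ∀ {x y z} → ¬ x ≈ 0# → x ⊗ y ≈ x ⊗ z → y ≈ z
  *-cancelˡ-nonZero {x} {y} {z} x≉0 xy≈xz with ∃-inverse x≉0
  ... | w , wx≈1 = begin
    y            ≈⟨ *-identityˡ y ⟨
    1# ⊗ y       ≈⟨ *-congʳ wx≈1 ⟨
    (w ⊗ x) ⊗ y  ≈⟨ *-assoc w x y ⟩
    w ⊗ (x ⊗ y)  ≈⟨ *-congˡ xy≈xz ⟩
    w ⊗ (x ⊗ z)  ≈⟨ *-assoc w x z ⟨
    (w ⊗ x) ⊗ z  ≈⟨ *-congʳ wx≈1 ⟩
    1# ⊗ z       ≈⟨ *-identityˡ z ⟩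
    z            ∎

  noZeroDivisors : ∀ {x y} → ¬ x ≈ 0# → x ⊗ y ≈ 0# → y ≈ 0#
  noZeroDivisors {x} x≉0 xy≈0 = *-cancelˡ-nonZero x≉0 (trans xy≈0 (sym (zeroʳ x)))

  ^-≈0 : ∀ x n → x ^ n ≈ 0# → x ≈ 0#
  ^-≈0 x zero    1≈0  = contradiction (sym 1≈0) 0≉1
  ^-≈0 x (suc n) xxⁿ≈0 with x ≟ 0#
  ... | yes x≈0 = x≈0
  ... | no  x≉0 = ^-≈0 x n (noZeroDivisors x≉0 xxⁿ≈0)

  1<q : 1 ℕ.< q
  1<q = ℕ.≰⇒> λ q≤1 → 0≉1 (index-injective (all-equal q≤1 (index 0#) (index 1#)))
    where
    all-equal : ∀ {n} → n ℕ.≤ 1 → (i j : Fin n) → i ≡ j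
    all-equal (s≤s z≤n) zero zero = ≡.refl

  module _ {f g : Carrier → Carrier}
           (f-cong : ∀ {x y} → x ≈ y → f x ≈ f y) (g-cong : ∀ {x y} → x ≈ y → g x ≈ g y)
           (fg≈id : ∀ x → f (g x) ≈ x) (gf≈id : ∀ x → g (f x) ≈ x) where

    bijection⇒permutation : Permutation′ q
    bijection⇒permutation = permutation (index ∘ f ∘ element) (index ∘ g ∘ element)
      (λ i → ≡.trans (index-cong (trans (f-cong (element-index _)) (fg≈id _))) (index-element i))
      (λ i → ≡.trans (index-cong (trans (g-cong (element-index _)) (gf≈id _))) (index-element i))

  -- Translation by `x` permutes `K`, so adding `x` to each of the `q` terms of the sum of all
  -- elements leaves it unchanged; cancel that sum.
  q·x≈0 : ∀ x → q · x ≈ 0#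
  q·x≈0 x = +-cancelˡ (sum element) (q · x) 0# (begin
    sum element ⊕ q · x                ≈⟨ +-congˡ (sum-replicate q) ⟨
    sum element ⊕ sum {q} (const x)    ≈⟨ ∑-distrib-+ element (const x) ⟨
    sum (λ i → element i ⊕ x)          ≈⟨ sum-cong-≋ (λ i → element-index (element i ⊕ x)) ⟨
    sum (element ∘ (π ⟨$⟩ʳ_))          ≈⟨ sum-permute element π ⟨
    sum element                        ≈⟨ +-identityʳ _ ⟨
    sum element ⊕ 0#                   ∎)
    where
    open MonoidSum +-commutativeMonoid
    π : Permutation′ q
    π = bijection⇒permutation {_⊕ x} {_⊕ (- x)} +-congʳ +-congʳ
      (λ y → trans (+-assoc _ _ _) (trans (+-congˡ (-‿inverseˡ x)) (+-identityʳ y)))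
      (λ y → trans (+-assoc _ _ _) (trans (+-congˡ (-‿inverseʳ x)) (+-identityʳ y)))

  module _ where
    open MonoidSum *-commutativeMonoid renaming (sum to product)

    product-nonZero : ∀ {n} {f : Fin n → Carrier} → (∀ i → ¬ f i ≈ 0#) → ¬ product f ≈ 0#
    product-nonZero {zero}  f≉0 1≈0 = 0≉1 (sym 1≈0)
    product-nonZero {suc n} f≉0 ff≈0 =
      product-nonZero (f≉0 ∘ suc) (noZeroDivisors (f≉0 zero) ff≈0)

    private
      -- Since unless0 x (x y) = x (unless0 1 y) for x ≠ 0 and every y, the products
      -- below can run over all of K instead of its units.
      unless0 : Carrier → Carrier → Carrier
      unless0 z y with y ≟ 0#
      ... | yes _ = z
      ... | no  _ = y

      unless0-zero : ∀ z {y} → y ≈ 0# → unless0 z y ≈ z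
      unless0-zero z {y} y≈0 with y ≟ 0#
      ... | yes _   = refl
      ... | no  y≉0 = contradiction y≈0 y≉0

      unless0-nonZero : ∀ z {y} → ¬ y ≈ 0# → unless0 z y ≈ y
      unless0-nonZero z {y} y≉0 with y ≟ 0#
      ... | yes y≈0 = contradiction y≈0 y≉0
      ... | no  _   = refl

      unless0-cong : ∀ z {y y′} → y ≈ y′ → unless0 z y ≈ unless0 z y′
      unless0-cong z {y} {y′} y≈y′ with y ≟ 0#
      ... | yes y≈0 = sym (unless0-zero z (trans (sym y≈y′) y≈0))
      ... | no  y≉0 = trans y≈y′ (sym (unless0-nonZero z (y≉0 ∘ trans y≈y′)))

    -- For nonzero `x`, multiplication by `x` permutes `K`. Scaling all `q` factors of `P` only
    -- rearranges them, except that the factor standing for zero becomes `x` instead of 1;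
    -- cancelling `P` leaves the exponent `q` rather than `q - 1`.
    x^q≈x : ∀ x → x ^ q ≈ x
    x^q≈x x with x ≟ 0#
    ... | yes x≈0 = trans (power 1<q) (sym x≈0)
      where
      power : ∀ {n} → 1 ℕ.< n → x ^ n ≈ 0#
      power {suc n} _ = trans (*-congʳ x≈0) (zeroˡ _)
    ... | no  x≉0 = *-cancelˡ-nonZero (product-nonZero P-nonZero) (begin
      P ⊗ (x ^ q)                                   ≈⟨ *-comm _ _ ⟩
      (x ^ q) ⊗ P                                   ≈⟨ *-congʳ (sum-replicate q) ⟨
      product {q} (const x) ⊗ P                     ≈⟨ ∑-distrib-+ {q} (const x) _ ⟨
      product (λ i → x ⊗ unless0 1# (element i))    ≈⟨ sum-cong-≋ (λ i → scale (element i)) ⟨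
      product (λ i → unless0 x (x ⊗ element i))     ≈⟨ sum-cong-≋ {q} (λ i → unless0-cong x (element-index _)) ⟨
      product (λ i → unless0 x (element (π ⟨$⟩ʳ i))) ≈⟨ sum-permute (unless0 x ∘ element) π ⟨
      product (unless0 x ∘ element)                 ≈⟨ sum-replace *-commutativeMonoid (index 0#)
                                                         (unless0-zero x (element-index 0#))
                                                         (unless0-zero 1# (element-index 0#))
                                                         agree ⟩
      x ⊗ P                                         ≈⟨ *-comm _ _ ⟩
      P ⊗ x                                         ∎)
      where
      P = product (unless0 1# ∘ element)
      y = proj₁ (∃-inverse x≉0)
      yx≈1 = proj₂ (∃-inverse x≉0)
      P-nonZero : ∀ i → ¬ unless0 1# (element i) ≈ 0#
      P-nonZero i eq with element i ≟ 0#
      ... | yes _  = 0≉1 (sym eq)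
      ... | no  ≉0 = ≉0 eq
      π : Permutation′ q
      π = bijection⇒permutation {x ⊗_} {y ⊗_} *-congˡ *-congˡ
        (λ z → trans (sym (*-assoc _ _ _))
          (trans (*-congʳ (trans (*-comm x y) yx≈1)) (*-identityˡ z)))
        (λ z → trans (sym (*-assoc _ _ _)) (trans (*-congʳ yx≈1) (*-identityˡ z)))
      scale : ∀ z → unless0 x (x ⊗ z) ≈ x ⊗ unless0 1# z
      scale z with z ≟ 0#
      ... | yes z≈0 = trans (unless0-zero x (trans (*-congˡ z≈0) (zeroʳ x))) (sym (*-identityʳ x))
      ... | no  z≉0 = unless0-nonZero x (z≉0 ∘ noZeroDivisors x≉0)
      agree : ∀ j → ¬ j ≡ index 0# → unless0 x (element j) ≈ unless0 1# (element j)
      agree j j≢0 = trans (unless0-nonZero x ≉0) (sym (unless0-nonZero 1# ≉0))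
        where
        ≉0 : ¬ element j ≈ 0#
        ≉0 ≈0 = j≢0 (≡.trans (≡.sym (index-element j)) (index-cong ≈0))

  x^[q^m]≈x : ∀ m x → x ^ (q ℕ.^ m) ≈ x
  x^[q^m]≈x zero    x = *-identityʳ x
  x^[q^m]≈x (suc m) x = begin
    x ^ (q ℕ.* q ℕ.^ m)    ≈⟨ ^-assocʳ x q (q ℕ.^ m) ⟨
    (x ^ q) ^ (q ℕ.^ m)    ≈⟨ ^-congˡ (q ℕ.^ m) (x^q≈x x) ⟩
    x ^ (q ℕ.^ m)          ≈⟨ x^[q^m]≈x m x ⟩
    x                      ∎

-- Polynomials and division with remainder.

module Polynomials {c ℓ} (A : CommutativeRing c ℓ) where
  open CommutativeRing A hiding (zero)
  open import Relation.Binary.Reasoning.Setoid setoid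
  open SemiringSolver commutativeSemiring using (solve; _:=_; _:+_; _:*_; con)

  -- The polynomial with lower coefficients cs and top coefficient t: monic
  -- polynomials have t = 1#, and t = 0# gives polynomials of degree < n.
  eval : ∀ {n} → Carrier → Vec Carrier n → Carrier → Carrier
  eval t []       x = t
  eval t (c ∷ cs) x = c + x * eval t cs x

  -- Synthetic division: the lower coefficients of the quotient are the values at `a` of the tails
  -- of `s`.
  factor : ∀ {n} (s : Vec Carrier (suc n)) a →
           ∃[ s′ ] ∀ x → eval 1# s x ≈ (x - a) * eval {n} 1# s′ x + eval 1# s a
  factor (c ∷ []) a = [] , λ x → begin
    c + x * 1#                        ≈⟨ +-identityˡ _ ⟨
    -- The solver works in semirings and sees `- a` as a separate variable `n`, so the zero
    -- `- a + a` is inserted beforehand.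
    0# + (c + x * 1#)                 ≈⟨ +-congʳ (-‿inverseˡ a) ⟨
    (- a + a) + (c + x * 1#)          ≈⟨ solve 4 (λ x a n c →
                                           (n :+ a) :+ (c :+ x :* con 1)
                                             := (x :+ n) :* con 1 :+ (c :+ a :* con 1))
                                           refl x a (- a) c ⟩
    (x - a) * 1# + (c + a * 1#)       ∎
  factor (c ∷ s@(_ ∷ _)) a with factor s a
  ... | s′ , s≈ = eval 1# s a ∷ s′ , λ x → begin
    c + x * eval 1# s x                               ≈⟨ +-congˡ (*-congˡ (s≈ x)) ⟩
    c + x * ((x - a) * eval 1# s′ x + eval 1# s a)    ≈⟨ +-identityʳ _ ⟨
    c + x * ((x - a) * eval 1# s′ x + eval 1# s a) + 0#
      ≈⟨ +-congˡ (trans (*-congʳ (-‿inverseˡ a)) (zeroˡ _)) ⟨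
    c + x * ((x - a) * eval 1# s′ x + eval 1# s a) + (- a + a) * eval 1# s a
      ≈⟨ solve 6 (λ x a n c e s →
           c :+ x :* ((x :+ n) :* e :+ s) :+ (n :+ a) :* s
             := (x :+ n) :* (s :+ x :* e) :+ (c :+ a :* s))
           refl x a (- a) c (eval 1# s′ x) (eval 1# s a) ⟩
    (x - a) * (eval 1# s a + x * eval 1# s′ x) + (c + a * eval 1# s a)  ∎

-- Expressions for elements of a subring of A.  Nothing is required of the
-- expressions themselves, so that lists serve as polynomials.
record Presentation {c ℓ} (A : CommutativeRing c ℓ) : Set (lsuc lzero ⊔ c ⊔ ℓ) where
  open CommutativeRing A
  field
    Expr : Set
    0′ 1′ : Expr
    _+′_ _*′_ : Expr → Expr → Expr
    -′_ : Expr → Expr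
    ⟦_⟧ : Expr → Carrier
    0-homo : ⟦ 0′ ⟧ ≈ 0#
    1-homo : ⟦ 1′ ⟧ ≈ 1#
    +-homo : ∀ x y → ⟦ x +′ y ⟧ ≈ ⟦ x ⟧ + ⟦ y ⟧
    *-homo : ∀ x y → ⟦ x *′ y ⟧ ≈ ⟦ x ⟧ * ⟦ y ⟧
    -‿homo : ∀ x → ⟦ -′ x ⟧ ≈ - ⟦ x ⟧

module Division {c ℓ} {A : CommutativeRing c ℓ} (P : Presentation A) where
  open CommutativeRing A hiding (zero)
  open Polynomials A
  open Presentation P
  open import Relation.Binary.Reasoning.Setoid setoid
  open SemiringSolver commutativeSemiring using (solve; _:=_; _:+_; _:*_; con)

  evalExpr : ∀ {n} → Carrier → Vec Expr n → Carrier → Carrier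
  evalExpr t cs = eval t (Vec.map ⟦_⟧ cs)

  -- One step of the long division by f.
  shift : ∀ {d} (f r : Vec Expr d) c → ∃₂ λ t (r′ : Vec Expr d) → ∀ x →
          ⟦ c ⟧ + x * evalExpr 0# r x ≈ ⟦ t ⟧ * evalExpr 1# f x + evalExpr 0# r′ x
  shift [] [] c = c , [] , λ x →
    solve 2 (λ c x → c :+ x :* con 0 := c :* con 1 :+ con 0) refl ⟦ c ⟧ x
  shift (f₀ ∷ f) (r₀ ∷ r) c with shift f r r₀
  ... | t , r′ , eq = t , (c +′ (-′ (t *′ f₀))) ∷ r′ , λ x →
    let F = evalExpr 1# f x ; R = evalExpr 0# r′ x ; n = - (⟦ t ⟧ * ⟦ f₀ ⟧) in begin
    ⟦ c ⟧ + x * (⟦ r₀ ⟧ + x * evalExpr 0# r x)        ≈⟨ +-congˡ (*-congˡ (eq x)) ⟩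
    ⟦ c ⟧ + x * (⟦ t ⟧ * F + R)                       ≈⟨ +-identityˡ _ ⟨
    0# + (⟦ c ⟧ + x * (⟦ t ⟧ * F + R))                ≈⟨ +-congʳ (-‿inverseʳ _) ⟨
    (⟦ t ⟧ * ⟦ f₀ ⟧ + n) + (⟦ c ⟧ + x * (⟦ t ⟧ * F + R))
      ≈⟨ solve 7 (λ t f₀ n c x F R →
           (t :* f₀ :+ n) :+ (c :+ x :* (t :* F :+ R))
             := t :* (f₀ :+ x :* F) :+ ((c :+ n) :+ x :* R))
           refl ⟦ t ⟧ ⟦ f₀ ⟧ n ⟦ c ⟧ x F R ⟩
    ⟦ t ⟧ * (⟦ f₀ ⟧ + x * F) + ((⟦ c ⟧ + n) + x * R)
      ≈⟨ +-congˡ (+-congʳ (trans (+-homo _ _) (+-congˡ (trans (-‿homo _) (-‿cong (*-homo _ _)))))) ⟨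
    ⟦ t ⟧ * (⟦ f₀ ⟧ + x * F) + (⟦ c +′ (-′ (t *′ f₀)) ⟧ + x * R)  ∎

  -- Base case of `divide`: in equal degrees the quotient is 1 and the leading terms cancel.
  monic-difference : ∀ {d} (g f : Vec Expr d) → ∃[ r ] ∀ x →
                     evalExpr 1# g x ≈ evalExpr 1# f x + evalExpr {d} 0# r x
  monic-difference []       []       = [] , λ x → sym (+-identityʳ 1#)
  monic-difference (g₀ ∷ g) (f₀ ∷ f) with monic-difference g f
  ... | r , eq = (g₀ +′ (-′ f₀)) ∷ r , λ x →
    let F = evalExpr 1# f x ; R = evalExpr 0# r x in begin
    ⟦ g₀ ⟧ + x * evalExpr 1# g x                       ≈⟨ +-congˡ (*-congˡ (eq x)) ⟩
    ⟦ g₀ ⟧ + x * (F + R)                               ≈⟨ +-identityˡ _ ⟨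
    0# + (⟦ g₀ ⟧ + x * (F + R))                        ≈⟨ +-congʳ (-‿inverseʳ _) ⟨
    (⟦ f₀ ⟧ - ⟦ f₀ ⟧) + (⟦ g₀ ⟧ + x * (F + R))
      ≈⟨ solve 6 (λ f₀ n g₀ x F R →
           (f₀ :+ n) :+ (g₀ :+ x :* (F :+ R)) := (f₀ :+ x :* F) :+ ((g₀ :+ n) :+ x :* R))
           refl ⟦ f₀ ⟧ (- ⟦ f₀ ⟧) ⟦ g₀ ⟧ x F R ⟩
    (⟦ f₀ ⟧ + x * F) + ((⟦ g₀ ⟧ - ⟦ f₀ ⟧) + x * R)
      ≈⟨ +-congˡ (+-congʳ (trans (+-homo _ _) (+-congˡ (-‿homo _)))) ⟨
    (⟦ f₀ ⟧ + x * F) + (⟦ g₀ +′ (-′ f₀) ⟧ + x * R)  ∎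

  -- `f` is monic, so no coefficient is ever inverted. The identity is between values at all points
  -- of `A`, and can be read in each coordinate of a product ring.
  divide : ∀ e {d} (g : Vec Expr (e ℕ.+ d)) (f : Vec Expr d) →
           ∃₂ λ (s : Vec Expr e) (r : Vec Expr d) → ∀ x →
           evalExpr 1# g x ≈ evalExpr 1# f x * evalExpr 1# s x + evalExpr 0# r x
  divide zero    g f with monic-difference g f
  ... | r , eq = [] , r , λ x → trans (eq x) (+-congʳ (sym (*-identityʳ _)))
  divide (suc e) (c ∷ g) f with divide e g f
  ... | s , r , g≈ with shift f r c
  -- `c + x * r` may have degree `d`; reducing it by `f` yields the constant coefficient `t` of the
  -- new quotient.
  ... | t , r′ , r≈ = t ∷ s , r′ , λ x →
    let F = evalExpr 1# f x ; S = evalExpr 1# s x ; R = evalExpr 0# r x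
        R′ = evalExpr 0# r′ x in begin
    ⟦ c ⟧ + x * evalExpr 1# g x           ≈⟨ +-congˡ (*-congˡ (g≈ x)) ⟩
    ⟦ c ⟧ + x * (F * S + R)               ≈⟨ solve 5 (λ c x F S R →
                                               c :+ x :* (F :* S :+ R)
                                                 := x :* (F :* S) :+ (c :+ x :* R))
                                               refl ⟦ c ⟧ x F S R ⟩
    x * (F * S) + (⟦ c ⟧ + x * R)         ≈⟨ +-congˡ (r≈ x) ⟩
    x * (F * S) + (⟦ t ⟧ * F + R′)        ≈⟨ solve 5 (λ x F S t R →
                                               x :* (F :* S) :+ (t :* F :+ R)
                                                 := F :* (t :+ x :* S) :+ R)
                                               refl x F S ⟦ t ⟧ R′ ⟩
    F * (⟦ t ⟧ + x * S) + R′              ∎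

-- Adjoining one element to a subring.

module Adjunction {c ℓ} {A : CommutativeRing c ℓ} (P : Presentation A)
                  (a : CommutativeRing.Carrier A) where
  open CommutativeRing A hiding (zero)
  open RingProperties ring
  open Presentation P
  open Division P
  open import Relation.Binary.Reasoning.Setoid setoid
  open SemiringSolver commutativeSemiring using (solve; _:=_; _:+_; _:*_; con)

  value : List Expr → Carrier
  value []       = 0#
  value (c ∷ cs) = ⟦ c ⟧ + a * value cs

  private
    _⊞_ : List Expr → List Expr → List Expr
    []       ⊞ ds       = ds
    (c ∷ cs) ⊞ []       = c ∷ cs
    (c ∷ cs) ⊞ (d ∷ ds) = (c +′ d) ∷ (cs ⊞ ds)

    _⊠_ : List Expr → List Expr → List Expr
    []       ⊠ ds = []
    (c ∷ cs) ⊠ ds = List.map (c *′_) ds ⊞ (0′ ∷ (cs ⊠ ds))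

    ⊞-homo : ∀ cs ds → value (cs ⊞ ds) ≈ value cs + value ds
    ⊞-homo []       ds       = sym (+-identityˡ _)
    ⊞-homo (c ∷ cs) []       = sym (+-identityʳ _)
    ⊞-homo (c ∷ cs) (d ∷ ds) = trans
      (+-cong (+-homo c d) (*-congˡ (⊞-homo cs ds)))
      (solve 5 (λ c d a x y → (c :+ d) :+ a :* (x :+ y) := (c :+ a :* x) :+ (d :+ a :* y))
        refl ⟦ c ⟧ ⟦ d ⟧ a (value cs) (value ds))

    scale-homo : ∀ c ds → value (List.map (c *′_) ds) ≈ ⟦ c ⟧ * value ds
    scale-homo c []       = sym (zeroʳ _)
    scale-homo c (d ∷ ds) = trans
      (+-cong (*-homo c d) (*-congˡ (scale-homo c ds)))
      (solve 4 (λ c d a x → c :* d :+ a :* (c :* x) := c :* (d :+ a :* x))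
        refl ⟦ c ⟧ ⟦ d ⟧ a (value ds))

    ⊠-homo : ∀ cs ds → value (cs ⊠ ds) ≈ value cs * value ds
    ⊠-homo []       ds = sym (zeroˡ _)
    ⊠-homo (c ∷ cs) ds = begin
      value (List.map (c *′_) ds ⊞ (0′ ∷ (cs ⊠ ds)))
        ≈⟨ ⊞-homo (List.map (c *′_) ds) _ ⟩
      value (List.map (c *′_) ds) + (⟦ 0′ ⟧ + a * value (cs ⊠ ds))
        ≈⟨ +-cong (scale-homo c ds) (+-cong 0-homo (*-congˡ (⊠-homo cs ds))) ⟩
      ⟦ c ⟧ * value ds + (0# + a * (value cs * value ds))
        ≈⟨ solve 4 (λ c a x y → c :* y :+ (con 0 :+ a :* (x :* y)) := (c :+ a :* x) :* y)
             refl ⟦ c ⟧ a (value cs) (value ds) ⟩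
      (⟦ c ⟧ + a * value cs) * value ds  ∎

    neg-homo : ∀ cs → value (List.map -′_ cs) ≈ - value cs
    neg-homo []       = sym -0#≈0#
    neg-homo (c ∷ cs) = trans
      (+-cong (-‿homo c) (trans (*-congˡ (neg-homo cs)) (sym (-‿distribʳ-* _ _))))
      (-‿+-comm _ _)

  value-constant : ∀ c → value (c ∷ []) ≈ ⟦ c ⟧
  value-constant c = trans (+-congˡ (zeroʳ a)) (+-identityʳ _)

  value-generator : value (0′ ∷ 1′ ∷ []) ≈ a
  value-generator = begin
    ⟦ 0′ ⟧ + a * value (1′ ∷ [])  ≈⟨ +-cong 0-homo (*-congˡ (trans (value-constant 1′) 1-homo)) ⟩
    0# + a * 1#                   ≈⟨ solve 1 (λ a → con 0 :+ a :* con 1 := a) refl a ⟩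
    a                             ∎

  adjoin : Presentation A
  adjoin = record
    { Expr = List Expr
    ; 0′ = []
    ; 1′ = 1′ ∷ []
    ; _+′_ = _⊞_
    ; _*′_ = _⊠_
    ; -′_ = List.map -′_
    ; ⟦_⟧ = value
    ; 0-homo = refl
    ; 1-homo = trans (value-constant 1′) 1-homo
    ; +-homo = ⊞-homo
    ; *-homo = ⊠-homo
    ; -‿homo = neg-homo
    }

  module _ {d} (f : Vec Expr d) (f[a]≈0 : evalExpr 1# f a ≈ 0#) where

    -- Since `f` vanishes at `a`, subtracting multiples of `f` does not change the value at `a`.
    reduce : ∀ cs → ∃[ r ] value cs ≈ evalExpr {d} 0# r a
    reduce []       = Vec.replicate d 0′ , sym (eval-zero d)
      where
      eval-zero : ∀ n → evalExpr 0# (Vec.replicate n 0′) a ≈ 0#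
      eval-zero zero    = refl
      eval-zero (suc n) = trans (+-cong 0-homo (trans (*-congˡ (eval-zero n)) (zeroʳ a)))
                                (+-identityˡ 0#)
    reduce (c ∷ cs) with reduce cs
    ... | r , cs≈r with shift f r c
    ... | t , r′ , eq = r′ , (begin
      ⟦ c ⟧ + a * value cs                              ≈⟨ +-congˡ (*-congˡ cs≈r) ⟩
      ⟦ c ⟧ + a * evalExpr 0# r a                       ≈⟨ eq a ⟩
      ⟦ t ⟧ * evalExpr 1# f a + evalExpr 0# r′ a        ≈⟨ +-congʳ (trans (*-congˡ f[a]≈0) (zeroʳ _)) ⟩
      0# + evalExpr 0# r′ a                             ≈⟨ +-identityˡ _ ⟩
      evalExpr 0# r′ a                                  ∎)

-- The embedding of K into L

module Roots {c ℓ q} (L : FiniteField c ℓ q) where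
  open FieldProperties L
  open Polynomials commutativeRing

  -- The remaining points are roots of the quotient by `X - x zero`: their differences from `x zero`
  -- are nonzero and there are no zero divisors.
  monic-roots≤degree : ∀ n (s : Vec Carrier n) (x : Fin (suc n) → Carrier) →
                       (∀ {i j} → x i ≈ x j → i ≡ j) → ¬ (∀ i → eval 1# s (x i) ≈ 0#)
  monic-roots≤degree zero    [] x x-inj roots = 0≉1 (sym (roots zero))
  monic-roots≤degree (suc n) s  x x-inj roots with factor s (x zero)
  ... | s′ , s≈ = monic-roots≤degree n s′ (x ∘ suc) (Fin.suc-injective ∘ x-inj) λ i →
    noZeroDivisors (λ xᵢ-x₀≈0 → contradiction (x-inj (x≈y xᵢ-x₀≈0)) λ ())
      (trans (sym (+-identityʳ _)) (trans (+-congˡ (sym (roots zero)))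
        (trans (sym (s≈ (x (suc i)))) (roots (suc i)))))
    where
    x≈y : ∀ {x y} → x - y ≈ 0# → x ≈ y
    x≈y = x∙y⁻¹≈ε⇒x≈y _ _

  monic-nonvanishing : ∀ {n} → n ℕ.< q → (s : Vec Carrier n) →
                       ¬ (∀ i → eval 1# s (element i) ≈ 0#)
  monic-nonvanishing n<q s roots = monic-roots≤degree _ s (λ i → element (Fin.inject≤ i n<q))
    (λ eq → Fin.inject≤-injective _ _ _ _ (element-injective eq)) (λ i → roots _)

-- Characteristic and prime field.

module PrimeField {c ℓ q} (K : FiniteField c ℓ q) where
  open FieldProperties K
  open Mult semiring using (×1-homo-*)
  open MonoidMult +-monoid using (×-homo-+; ×-congˡ)
  open import Relation.Binary.Reasoning.Setoid ≈-setoid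

  ^·1-homo : ∀ p e → (p ℕ.^ e) · 1# ≈ (p · 1#) ^ e
  ^·1-homo p zero    = +-identityʳ 1#
  ^·1-homo p (suc e) = trans (×1-homo-* p (p ℕ.^ e)) (*-congˡ (^·1-homo p e))

  -- `(p · 1#) ^ e` equals `q · 1#`, which is zero, and in a field a power vanishes only if its base
  -- does.
  characteristic : ∀ {p e} → q ≡ p ℕ.^ e → p · 1# ≈ 0#
  characteristic {p} {e} q≡p^e = ^-≈0 _ e (trans (sym (^·1-homo p e))
    (trans (×-congˡ (≡.sym q≡p^e)) (q·x≈0 1#)))

  ∣⇒·1≈0 : ∀ {p n} → p · 1# ≈ 0# → p ∣ n → n · 1# ≈ 0#
  ∣⇒·1≈0 {p} p·1≈0 (divides k ≡.refl) =
    trans (×1-homo-* k p) (trans (*-congˡ p·1≈0) (zeroʳ _))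

  -- Otherwise `p` and `n` would be coprime, and a Bézout identity between them would read `1# ≈ 0#`
  -- in `K`.
  ·1≈0⇒∣ : ∀ {p n} → Prime p → p · 1# ≈ 0# → n · 1# ≈ 0# → p ∣ n
  ·1≈0⇒∣ {p} {n} p-prime p·1≈0 n·1≈0 with p ∣? n
  ... | yes p∣n = p∣n
  ... | no  p∤n = contradiction (bézout (Coprimality.coprime-Bézout coprime)) (0≉1 ∘ sym)
    where
    coprime : Coprimality.Coprime p n
    coprime (d∣p , d∣n) with prime⇒irreducible p-prime d∣p
    ... | inj₁ d≡1    = d≡1
    ... | inj₂ ≡.refl = contradiction d∣n p∤n

    1+multiple : ∀ k l {x y} → x · 1# ≈ 0# → y · 1# ≈ 0# → 1 ℕ.+ k ℕ.* x ≡ l ℕ.* y → 1# ≈ 0#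
    1+multiple k l {x} {y} x·1≈0 y·1≈0 eq = begin
      1#                        ≈⟨ +-identityʳ 1# ⟨
      1# ⊕ 0#                   ≈⟨ +-congˡ (∣⇒·1≈0 x·1≈0 (divides k ≡.refl)) ⟨
      (1 ℕ.+ k ℕ.* x) · 1#      ≈⟨ ∣⇒·1≈0 y·1≈0 (divides l eq) ⟩
      0#                        ∎

    bézout : Bézout.Identity 1 p n → 1# ≈ 0#
    bézout (Bézout.+- x y eq) = 1+multiple y x n·1≈0 p·1≈0 eq
    bézout (Bézout.-+ x y eq) = 1+multiple x y p·1≈0 n·1≈0 eq

  -- When `n` acts as zero, `pred n` acts as minus one; this supplies the negation on natural
  -- numbers as expressions for the prime field.
  pred-·1 : ∀ n → n · 1# ≈ 0# → ∀ {x} → 1 ℕ.≤ n → (ℕ.pred n ℕ.* x) · 1# ≈ - (x · 1#)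
  pred-·1 (suc n) 1+n·1≈0 {x} _ = +-inverseʳ-unique _ _ (begin
    x · 1# ⊕ (n ℕ.* x) · 1#   ≈⟨ ×-homo-+ 1# x (n ℕ.* x) ⟨
    (suc n ℕ.* x) · 1#        ≈⟨ ×1-homo-* (suc n) x ⟩
    (suc n · 1#) ⊗ (x · 1#)   ≈⟨ *-congʳ 1+n·1≈0 ⟩
    0# ⊗ (x · 1#)             ≈⟨ zeroˡ _ ⟩
    0#                        ∎)

record Embedding {c ℓ c′ ℓ′ q Q} (K : FiniteField c ℓ q) (L : FiniteField c′ ℓ′ Q) :
                 Set (c ⊔ ℓ ⊔ c′ ⊔ ℓ′) where
  private
    module K = FiniteField K
    module L = FiniteField L
  field
    φ      : K.Carrier → L.Carrier
    φ-cong : ∀ {x y} → x K.≈ y → φ x L.≈ φ y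
    φ-+    : ∀ x y → φ (x K.⊕ y) L.≈ φ x L.⊕ φ y
    φ-*    : ∀ x y → φ (x K.⊗ y) L.≈ φ x L.⊗ φ y
    φ-1    : φ K.1# L.≈ L.1#

-- Extending partial embeddings.

module EmbeddingExistence {c ℓ c′ ℓ′ q m} (q-pp : IsPrimePower q)
                          (K : FiniteField c ℓ q) (L : FiniteField c′ ℓ′ (q ℕ.^ m)) where
  private
    module K = FieldProperties K
    module L = FieldProperties L

  A : CommutativeRing (c ⊔ c′) (ℓ ⊔ ℓ′)
  A = DirectProduct.commutativeRing K.commutativeRing L.commutativeRing

  open CommutativeRing A using (0#; 1#)
  open Polynomials A using (eval)

  private
    Q : ℕ
    Q = q ℕ.^ m

    eval-proj₁ : ∀ {n} t (cs : Vec _ n) {α} β β′ →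
                 proj₁ (eval t cs (α , β)) ≡ proj₁ (eval t cs (α , β′))
    eval-proj₁ t []       β β′ = ≡.refl
    eval-proj₁ t (c ∷ cs) β β′ = ≡.cong (λ y → proj₁ c K.⊕ _ K.⊗ y) (eval-proj₁ t cs β β′)

    eval-proj₂ : ∀ {n} t (cs : Vec _ n) a → proj₂ (eval t cs a) ≡
                 Polynomials.eval L.commutativeRing (proj₂ t) (Vec.map proj₂ cs) (proj₂ a)
    eval-proj₂ t []       a = ≡.refl
    eval-proj₂ t (c ∷ cs) a = ≡.cong (λ y → proj₂ c L.⊕ _ L.⊗ y) (eval-proj₂ t cs a)

  -- A subring of K × L that is the graph of a homomorphism from a subring of K to L.
  record PartialEmbedding : Set (lsuc lzero ⊔ c ⊔ c′ ⊔ ℓ ⊔ ℓ′) where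
    field
      presentation : Presentation A
    open Presentation presentation public
    field
      functional : ∀ r → proj₁ ⟦ r ⟧ K.≈ K.0# → proj₂ ⟦ r ⟧ L.≈ L.0#

    Defined : K.Carrier → Set ℓ
    Defined x = ∃[ r ] proj₁ ⟦ r ⟧ K.≈ x

    -- The graph is closed under subtraction, so the condition at zero settles all other points.
    functional′ : ∀ r s → proj₁ ⟦ r ⟧ K.≈ proj₁ ⟦ s ⟧ → proj₂ ⟦ r ⟧ L.≈ proj₂ ⟦ s ⟧
    functional′ r s r≈s = L.x∙y⁻¹≈ε⇒x≈y _ _ (L.trans
      (L.sym (L.trans (proj₂ (+-homo r (-′ s))) (L.+-congˡ (proj₂ (-‿homo s)))))
      (functional (r +′ (-′ s)) (K.trans
        (K.trans (proj₁ (+-homo r (-′ s))) (K.+-congˡ (proj₁ (-‿homo s))))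
        (K.x≈y⇒x∙y⁻¹≈ε r≈s))))

  primeSubfield : PartialEmbedding
  primeSubfield = record
    { presentation = record
      { Expr = ℕ
      ; 0′ = 0
      ; 1′ = 1
      ; _+′_ = ℕ._+_
      ; _*′_ = ℕ._*_
      ; -′_ = λ x → ℕ.pred p ℕ.* x
      ; ⟦_⟧ = λ n → n K.· K.1# , n L.· L.1#
      ; 0-homo = K.refl , L.refl
      ; 1-homo = K.+-identityʳ _ , L.+-identityʳ _
      ; +-homo = λ x y → MonoidMult.×-homo-+ K.+-monoid K.1# x y
                       , MonoidMult.×-homo-+ L.+-monoid L.1# x y
      ; *-homo = λ x y → Mult.×1-homo-* K.semiring x y , Mult.×1-homo-* L.semiring x y
      ; -‿homo = λ x → PrimeField.pred-·1 K p pK≈0 1≤p , PrimeField.pred-·1 L p pL≈0 1≤p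
      }
    -- If `n` is zero in `K` then `p` divides `n`, and `p` is also zero in `L`, whose order is
    -- `p ^ (e * m)`.
    ; functional = λ n n≈0 → PrimeField.∣⇒·1≈0 L pL≈0 (PrimeField.·1≈0⇒∣ K {n = n} p-prime pK≈0 n≈0)
    }
    where
    p = proj₁ q-pp
    e = proj₁ (proj₂ q-pp)
    p-prime = proj₁ (proj₂ (proj₂ q-pp))
    q≡p^e = proj₂ (proj₂ (proj₂ (proj₂ q-pp)))
    pK≈0 : p K.· K.1# K.≈ K.0#
    pK≈0 = PrimeField.characteristic K {p} {e} q≡p^e
    pL≈0 : p L.· L.1# L.≈ L.0#
    pL≈0 = PrimeField.characteristic L {p} {e ℕ.* m}
      (≡.trans (≡.cong (ℕ._^ m) q≡p^e) (ℕ.^-*-assoc p e m))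
    1≤p : 1 ℕ.≤ p
    1≤p = ℕ.>-nonZero⁻¹ p {{prime⇒nonZero p-prime}}

  module Extension (S : PartialEmbedding) (α : K.Carrier) where
    open PartialEmbedding S
    open Division presentation

    Functional : L.Carrier → Set (ℓ ⊔ ℓ′)
    Functional β = ∀ r → proj₁ (value r) K.≈ K.0# → proj₂ (value r) L.≈ L.0#
      where open Adjunction presentation (α , β)

    extend : ∀ β → Functional β → PartialEmbedding
    extend β β-functional = record
      { presentation = Adjunction.adjoin presentation (α , β)
      ; functional = β-functional
      }

    private
      pow : Expr → ℕ → Expr
      pow c zero    = 1′
      pow c (suc n) = c *′ pow c n

      pow-homo : ∀ c n → proj₁ ⟦ pow c n ⟧ K.≈ proj₁ ⟦ c ⟧ K.^ n
      pow-homo c zero    = proj₁ 1-homo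
      pow-homo c (suc n) = K.trans (proj₁ (*-homo c (pow c n))) (K.*-congˡ (pow-homo c n))

      -- From `c ^ q ≈ c` the power with exponent `q - 2` is inverse to `c`, so ring operations
      -- alone already reach inverses in the `K` coordinate.
      ∃-inverse : ∀ c → ¬ proj₁ ⟦ c ⟧ K.≈ K.0# → ∃[ u ] proj₁ ⟦ u ⟧ K.⊗ proj₁ ⟦ c ⟧ K.≈ K.1#
      ∃-inverse c c≉0 = from-power K.1<q (K.x^q≈x _)
        where
        from-power : ∀ {n} → 1 ℕ.< n → proj₁ ⟦ c ⟧ K.^ n K.≈ proj₁ ⟦ c ⟧ →
                     ∃[ u ] proj₁ ⟦ u ⟧ K.⊗ proj₁ ⟦ c ⟧ K.≈ K.1#
        from-power {suc (suc n)} _ cⁿ⁺²≈c = pow c n ,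
          K.trans (K.*-congʳ (pow-homo c n)) (K.trans (K.*-comm _ _)
            (K.*-cancelˡ-nonZero c≉0 (K.trans cⁿ⁺²≈c (K.sym (K.*-identityʳ _)))))
        from-power {suc zero} (s≤s ())

    Vanishing : ∀ {d} → Vec Expr d → Set ℓ
    Vanishing = All (λ c → proj₁ ⟦ c ⟧ K.≈ K.0#)

    -- The highest coefficients that vanish in `K` are dropped, and the inverse `u` of the next one
    -- makes the rest monic. This brings a remainder into the form to which minimality applies.
    normalise : ∀ {d} (r : Vec Expr d) → Vanishing r ⊎
                ∃[ k ] k ℕ.< d × ∃₂ λ u (s : Vec Expr k) → ∀ x →
                proj₁ ⟦ u ⟧ K.⊗ proj₁ (evalExpr 0# r x) K.≈ proj₁ (evalExpr 1# s x)
    normalise []      = inj₁ []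
    normalise (c ∷ r) with normalise r
    ... | inj₂ (k , k<d , u , s , us≈) = inj₂ (suc k , s≤s k<d , u , (u *′ c) ∷ s , λ x → begin
      ⟦u⟧ K.⊗ (proj₁ ⟦ c ⟧ K.⊕ proj₁ x K.⊗ E x)                ≈⟨ K.distribˡ _ _ _ ⟩
      ⟦u⟧ K.⊗ proj₁ ⟦ c ⟧ K.⊕ ⟦u⟧ K.⊗ (proj₁ x K.⊗ E x)
        ≈⟨ K.+-cong (K.sym (proj₁ (*-homo u c))) (x∙yz≈y∙xz _ _ _) ⟩
      proj₁ ⟦ u *′ c ⟧ K.⊕ proj₁ x K.⊗ (⟦u⟧ K.⊗ E x)            ≈⟨ K.+-congˡ (K.*-congˡ (us≈ x)) ⟩
      proj₁ ⟦ u *′ c ⟧ K.⊕ proj₁ x K.⊗ proj₁ (evalExpr 1# s x)  ∎)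
      where
      open import Relation.Binary.Reasoning.Setoid K.≈-setoid
      open import Algebra.Properties.CommutativeSemigroup K.*-commutativeSemigroup using (x∙yz≈y∙xz)
      ⟦u⟧ = proj₁ ⟦ u ⟧
      E = λ x → proj₁ (evalExpr 0# r x)
    ... | inj₁ r≈0 with proj₁ ⟦ c ⟧ K.≟ K.0#
    ... | yes c≈0 = inj₁ (c≈0 ∷ r≈0)
    ... | no  c≉0 with ∃-inverse c c≉0
    ... | u , uc≈1 = inj₂ (0 , s≤s z≤n , u , [] , λ x → K.trans
      (K.*-congˡ (K.trans (K.+-congˡ (K.trans (K.*-congˡ (eval-vanishing r r≈0 x)) (K.zeroʳ _)))
                          (K.+-identityʳ _)))
      uc≈1)
      where
      eval-vanishing : ∀ {d} (r : Vec Expr d) → Vanishing r → ∀ x → proj₁ (evalExpr 0# r x) K.≈ K.0#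
      eval-vanishing []      []          x = K.refl
      eval-vanishing (c ∷ r) (c≈0 ∷ r≈0) x = K.trans
        (K.+-cong c≈0 (K.trans (K.*-congˡ (eval-vanishing r r≈0 x)) (K.zeroʳ _)))
        (K.+-identityʳ _)

    -- By `functional`, coefficients that are zero in `K` are zero in `L`; conclusions drawn in `K`
    -- pass to `L` this way.
    vanishing⇒eval≈0 : ∀ {d} (r : Vec Expr d) → Vanishing r → ∀ x → proj₂ (evalExpr 0# r x) L.≈ L.0#
    vanishing⇒eval≈0 []      []          x = L.refl
    vanishing⇒eval≈0 (c ∷ r) (c≈0 ∷ r≈0) x = L.trans
      (L.+-cong (functional c c≈0) (L.trans (L.*-congˡ (vanishing⇒eval≈0 r r≈0 x)) (L.zeroʳ _)))
      (L.+-identityʳ _)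

    -- `L.0#` is a placeholder: by `eval-proj₁` it does not affect the first coordinate.
    α-Root : ∀ {d} → Vec Expr d → Set ℓ
    α-Root f = proj₁ (evalExpr 1# f (α , L.0#)) K.≈ K.0#

    -- Both K and L consist of roots of X^Q - X.
    frobenius : ∃[ g ] ∀ a → let open CommutativeRing A using (_≈_) in evalExpr {Q} 1# g a ≈ 0#
    frobenius = polynomial L.1<q (λ a → K.x^[q^m]≈x m (proj₁ a) , L.x^q≈x (proj₂ a))
      where
      open CommutativeRing A hiding (0#; 1#; zero)
      open import Algebra.Properties.Semiring.Exp semiring using (_^_)
      open import Algebra.Properties.Ring ring using (-‿distribʳ-*)
      open import Relation.Binary.Reasoning.Setoid setoid
      polynomial : ∀ {n} → 1 ℕ.< n →
                   (∀ a → (proj₁ a K.^ n K.≈ proj₁ a) × (proj₂ a L.^ n L.≈ proj₂ a)) →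
                   ∃[ g ] ∀ a → evalExpr {n} 1# g a ≈ 0#
      -- Constant coefficient 0, then -1, then `n` zeros below the leading 1: the polynomial
      -- `X^(n+2) - X`.
      polynomial {suc (suc n)} _ a^n≈a = 0′ ∷ (-′ 1′) ∷ Vec.replicate n 0′ , λ a →
        begin
        ⟦ 0′ ⟧ + a * (⟦ -′ 1′ ⟧ + a * evalExpr 1# (Vec.replicate n 0′) a)
          ≈⟨ +-cong 0-homo (*-congˡ (+-cong (trans (-‿homo 1′) (-‿cong 1-homo)) (*-congˡ (monomial n a)))) ⟩
        0# + a * (- 1# + a * a ^ n)            ≈⟨ +-identityˡ _ ⟩
        a * (- 1# + a * a ^ n)                 ≈⟨ distribˡ _ _ _ ⟩
        a * - 1# + a * (a * a ^ n)
          ≈⟨ +-cong (trans (sym (-‿distribʳ-* a 1#)) (-‿cong (*-identityʳ a)))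
                    (trans (power a (suc (suc n))) (a^n≈a a)) ⟩
        - a + a                                ≈⟨ -‿inverseˡ a ⟩
        0#                                     ∎
        where
        monomial : ∀ n a → evalExpr 1# (Vec.replicate n 0′) a ≈ a ^ n
        monomial zero    a = refl
        monomial (suc n) a = trans (+-cong 0-homo (*-congˡ (monomial n a))) (+-identityˡ _)
        power : ∀ a n → a ^ n ≈ (proj₁ a K.^ n , proj₂ a L.^ n)
        power a zero    = refl
        power a (suc n) = *-congˡ (power a n)
      polynomial {suc zero} (s≤s ())

    module MinimalPolynomial {d} (d≤Q : d ℕ.≤ Q) (f : Vec Expr d) (f[α]≈0 : α-Root f)
                             (minimal : ∀ {k} → k ℕ.< d → (s : Vec Expr k) → ¬ α-Root s) where

      -- Otherwise `normalise` would produce a monic polynomial of degree below `d` with root `α`,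
      -- against `minimal`.
      root⇒vanishing : ∀ (r : Vec Expr d) β → proj₁ (evalExpr 0# r (α , β)) K.≈ K.0# → Vanishing r
      root⇒vanishing r β r[α]≈0 with normalise r
      ... | inj₁ r≈0 = r≈0
      ... | inj₂ (k , k<d , u , s , us≈) = contradiction
        (K.trans (K.reflexive (eval-proj₁ 1# (Vec.map ⟦_⟧ s) L.0# β))
          (K.trans (K.sym (us≈ (α , β))) (K.trans (K.*-congˡ r[α]≈0) (K.zeroʳ _))))
        (minimal k<d s)

      -- Modulo `f`, which vanishes at `α` and `β`, an expression becomes a polynomial `r` of degree
      -- below `d`. If its value in `K` is zero, its coefficients vanish in `K`, and hence its value
      -- in `L` is zero.
      root⇒functional : ∀ β → proj₂ (evalExpr 1# f (α , β)) L.≈ L.0# → Functional β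
      root⇒functional β f[β]≈0 cs cs≈0
        with Adjunction.reduce presentation (α , β) f
               (K.trans (K.reflexive (eval-proj₁ 1# (Vec.map ⟦_⟧ f) β L.0#)) f[α]≈0 , f[β]≈0) cs
      ... | r , cs≈r = L.trans (proj₂ cs≈r)
        (vanishing⇒eval≈0 r (root⇒vanishing r β (K.trans (K.sym (proj₁ cs≈r)) cs≈0)) _)

      -- Makes the degree `Q - d` of the quotient strictly smaller than the order of `L`.
      0<d : 0 ℕ.< d
      0<d = ℕ.n≢0⇒n>0 λ { ≡.refl → degree0 f f[α]≈0 }
        where
        degree0 : (f : Vec Expr 0) → ¬ α-Root f
        degree0 [] 1≈0 = K.0≉1 (K.sym 1≈0)

      ∃-root : ∃[ β ] proj₂ (evalExpr 1# f (α , β)) L.≈ L.0#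
      ∃-root with frobenius
      ... | g , g≈0 with divide (Q ℕ.∸ d) (≡.subst (Vec Expr) (≡.sym (ℕ.m∸n+n≡m d≤Q)) g) f
      ... | s , r , g≈fs+r
        with Fin.any? (λ i → proj₂ (evalExpr 1# f (α , L.element i)) L.≟ L.0#)
      ... | yes (i , f[β]≈0) = L.element i , f[β]≈0
      ... | no  no-root = contradiction
        (λ i → L.trans (L.reflexive (≡.sym (eval-proj₂ 1# (Vec.map ⟦_⟧ s) (α , L.element i))))
                 (L.noZeroDivisors (λ f[β]≈0 → no-root (i , f[β]≈0)) (fs≈0 (L.element i))))
        (Roots.monic-nonvanishing L (ℕ.∸-monoʳ-< 0<d d≤Q)
          (Vec.map proj₂ (Vec.map ⟦_⟧ s)))
        where
        open CommutativeRing A hiding (0#; 1#; zero)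
        fs+r≈0 : ∀ a → evalExpr 1# f a * evalExpr 1# s a + evalExpr 0# r a ≈ 0#
        fs+r≈0 a = trans (sym (g≈fs+r a)) (trans (reflexive (eval-subst (≡.sym (ℕ.m∸n+n≡m d≤Q)) a)) (g≈0 a))
          where
          eval-subst : ∀ {n} (eq : Q ≡ n) a →
                       evalExpr 1# (≡.subst (Vec Expr) eq g) a ≡ evalExpr 1# g a
          eval-subst ≡.refl a = ≡.refl
        -- At `α` both `f` and `X^Q - X` vanish, hence so does the remainder, and minimality forces
        -- its coefficients to vanish in `K`.
        r-vanishing : Vanishing r
        r-vanishing = root⇒vanishing r L.0# (K.trans (K.sym (K.+-identityˡ _))
          (K.trans (K.+-congʳ (K.sym (K.trans (K.*-congʳ f[α]≈0) (K.zeroˡ _))))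
            (proj₁ (fs+r≈0 (α , L.0#)))))
        fs≈0 : ∀ β → proj₂ (evalExpr 1# f (α , β)) L.⊗ proj₂ (evalExpr 1# s (α , β)) L.≈ L.0#
        fs≈0 β = L.trans (L.sym (L.+-identityʳ _))
          (L.trans (L.+-congˡ (L.sym (vanishing⇒eval≈0 r r-vanishing (α , β))))
            (proj₂ (fs+r≈0 (α , β))))

      ∃-functional : ∃ Functional
      ∃-functional with ∃-root
      ... | β , f[β]≈0 = β , root⇒functional β f[β]≈0

    -- Doubly negated, since it is not decided in which degrees there is a monic
    -- polynomial over Expr with root α.
    extendable : ¬ ¬ ∃ Functional
    extendable ¬extendable = no-root Q ℕ.≤-refl (proj₁ frobenius)
      (proj₁ (proj₂ frobenius (α , L.0#)))
      where
      no-root : ∀ d → d ℕ.≤ Q → (f : Vec Expr d) → ¬ α-Root f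
      -- Strong induction on the degree: ruling out all smaller degrees is exactly the minimality
      -- that `MinimalPolynomial` asks for. Degree `Q` then contradicts `X^Q - X`.
      no-root = <-rec (λ d → d ℕ.≤ Q → (f : Vec Expr d) → ¬ α-Root f) λ d rec d≤Q f f[α]≈0 →
        ¬extendable (MinimalPolynomial.∃-functional d≤Q f f[α]≈0
          (λ k<d → rec k<d (ℕ.≤-trans (ℕ.<⇒≤ k<d) d≤Q)))

  open PartialEmbedding using (Defined)

  -- The double negations compose because the goal is a contradiction. Elements reached earlier
  -- persist as constant polynomials, and the new one is the generator.
  definable : ∀ {n} (x : Fin n → K.Carrier) →
              ¬ ¬ (∃[ S ] ∀ i → Defined S (x i))
  definable {zero}  x ¬defined = ¬defined (primeSubfield , λ ())
  definable {suc n} x ¬defined = definable (x ∘ suc) λ (S , defined) →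
    Extension.extendable S (x zero) λ (β , β-functional) →
    let open Adjunction (PartialEmbedding.presentation S) (x zero , β) in
    ¬defined (Extension.extend S (x zero) β β-functional , λ
      { zero    → PartialEmbedding.0′ S ∷ PartialEmbedding.1′ S ∷ [] , proj₁ value-generator
      ; (suc i) → let (r , r≈x) = defined i in
                  r ∷ [] , K.trans (proj₁ (value-constant r)) r≈x })

  private
    -- A map is coded by its table of values on indices: it respects `_≈_` automatically, and there
    -- are finitely many candidates.
    decode : Fin (Q ℕ.^ q) → K.Carrier → L.Carrier
    decode t x = L.element (finToFun t (K.index x))

    decode-cong : ∀ t {x y} → x K.≈ y → decode t x L.≈ decode t y
    decode-cong t x≈y = L.reflexive (≡.cong (L.element ∘ finToFun t) (K.index-cong x≈y))

    IsHom : Fin (Q ℕ.^ q) → Set ℓ′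
    IsHom t =
      (∀ i j → decode t (K.element i K.⊕ K.element j)
                 L.≈ decode t (K.element i) L.⊕ decode t (K.element j)) ×
      (∀ i j → decode t (K.element i K.⊗ K.element j)
                 L.≈ decode t (K.element i) L.⊗ decode t (K.element j)) ×
      decode t K.1# L.≈ L.1#

    isHom? : ∀ t → Dec (IsHom t)
    isHom? t = Fin.all? (λ i → Fin.all? λ j → _ L.≟ _) ×-dec
               Fin.all? (λ i → Fin.all? λ j → _ L.≟ _) ×-dec (_ L.≟ _)

    -- The expression chosen for a sum need not be the sum of the chosen expressions, but both have
    -- the same `K` coordinate, so `functional′` identifies their `L` coordinates; likewise for
    -- products and 1.
    total⇒hom : ∀ S → (∀ i → Defined S (K.element i)) → ∃ IsHom
    total⇒hom S defined = funToFin t ,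
      (λ i j → L.trans (decode≈ _) (L.trans
        (functional′ (r _) (r₁ i +′ r₁ j) (K.trans (r≈ _) (K.sym (K.trans (proj₁ (+-homo _ _))
          (K.+-cong (r₁≈ i) (r₁≈ j))))))
        (L.trans (proj₂ (+-homo _ _)) (L.sym (L.+-cong (decode≈ _) (decode≈ _)))))) ,
      (λ i j → L.trans (decode≈ _) (L.trans
        (functional′ (r _) (r₁ i *′ r₁ j) (K.trans (r≈ _) (K.sym (K.trans (proj₁ (*-homo _ _))
          (K.*-cong (r₁≈ i) (r₁≈ j))))))
        (L.trans (proj₂ (*-homo _ _)) (L.sym (L.*-cong (decode≈ _) (decode≈ _)))))) ,
      L.trans (decode≈ _) (L.trans
        (functional′ (r _) 1′ (K.trans (r≈ _) (K.sym (proj₁ 1-homo)))) (proj₂ 1-homo))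
      where
      open PartialEmbedding S
      r : K.Carrier → Expr
      r x = proj₁ (defined (K.index x))
      r≈ : ∀ x → proj₁ ⟦ r x ⟧ K.≈ x
      r≈ x = K.trans (proj₂ (defined (K.index x))) (K.element-index x)
      r₁ : Fin q → Expr
      r₁ i = r (K.element i)
      r₁≈ : ∀ i → proj₁ ⟦ r₁ i ⟧ K.≈ K.element i
      r₁≈ i = r≈ (K.element i)
      t : Fin q → Fin Q
      t i = L.index (proj₂ ⟦ proj₁ (defined i) ⟧)
      decode≈ : ∀ x → decode (funToFin t) x L.≈ proj₂ ⟦ r x ⟧
      decode≈ x = L.trans (L.reflexive (≡.cong L.element (Fin.finToFun-funToFin t (K.index x))))
        (L.element-index _)

  -- There are finitely many maps K → L, so a homomorphism that cannot fail to
  -- exist is found by search.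
  embedding : Embedding K L
  embedding = record
    { φ = decode t
    ; φ-cong = decode-cong t
    ; φ-+ = λ x y → L.trans
        (decode-cong t (K.+-cong (K.sym (K.element-index x)) (K.sym (K.element-index y))))
        (L.trans (t-+ _ _)
          (L.+-cong (decode-cong t (K.element-index x)) (decode-cong t (K.element-index y))))
    ; φ-* = λ x y → L.trans
        (decode-cong t (K.*-cong (K.sym (K.element-index x)) (K.sym (K.element-index y))))
        (L.trans (t-* _ _)
          (L.*-cong (decode-cong t (K.element-index x)) (decode-cong t (K.element-index y))))
    ; φ-1 = t-1
    }
    where
    hom : ∃ IsHom
    hom = decidable-stable (Fin.any? isHom?) λ ¬hom →
      definable K.element λ (S , defined) → ¬hom (total⇒hom S defined)
    t = proj₁ hom
    t-+ = proj₁ (proj₂ hom)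
    t-* = proj₁ (proj₂ (proj₂ hom))
    t-1 = proj₂ (proj₂ (proj₂ hom))

-- Restriction of scalars from L to K

finToFun-injective : ∀ {m} n {s t : Fin (m ℕ.^ n)} →
                     (∀ i → finToFun {m} {n} s i ≡ finToFun t i) → s ≡ t
finToFun-injective {m} n {s} {t} eq = ≡.trans (≡.sym (Fin.funToFin-finToFin {n} s))
  (≡.trans (funToFin-cong eq) (Fin.funToFin-finToFin {n} t))
  where
  funToFin-cong : ∀ {k} {f g : Fin k → Fin m} → (∀ i → f i ≡ g i) → funToFin f ≡ funToFin g
  funToFin-cong {zero}  f≗g = ≡.refl
  funToFin-cong {suc k} f≗g = ≡.cong₂ combine (f≗g zero) (funToFin-cong (f≗g ∘ suc))

-- Row `i` lies in block `Q` and `i < m * (Q + 1)`; thus a cell outside the dilated diagram belongs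
-- to a block outside the original one.
m*g≤toℕ⇒g≤quotient : ∀ {k} m (i : Fin (k ℕ.* m)) {g} → m ℕ.* g ℕ.≤ toℕ i → g ℕ.≤ toℕ (quotient {k} m i)
m*g≤toℕ⇒g≤quotient {k} m i {g} mg≤i = ℕ.≤-pred (ℕ.*-cancelˡ-< m _ _ (begin-strict
  m ℕ.* g                          ≤⟨ mg≤i ⟩
  toℕ i                            ≡⟨ ≡.cong toℕ (Fin.combine-remQuot {k} m i) ⟨
  toℕ (combine Q R)                ≡⟨ Fin.toℕ-combine Q R ⟩
  m ℕ.* toℕ Q ℕ.+ toℕ R            <⟨ ℕ.+-monoʳ-< _ (Fin.toℕ<n R) ⟩
  m ℕ.* toℕ Q ℕ.+ m                ≡⟨ ℕ.+-comm _ m ⟩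
  m ℕ.+ m ℕ.* toℕ Q                ≡⟨ ℕ.*-suc m (toℕ Q) ⟨
  m ℕ.* suc (toℕ Q)                ∎))
  where
  open ℕ.≤-Reasoning
  Q = quotient {k} m i
  R = remainder {k} m i

module SpanProperties {c ℓ q} (K : FiniteField c ℓ q) {I : Set} where
  open FieldProperties K
  open SemiringSum semiring

  span-subspace : ∀ {d} (v : Fin d → Space K I) → IsSubspace K (Span K v)
  span-subspace {d} v = record
    { respects = λ u≈v (x , u≈) → x , λ i → trans (sym (u≈v i)) (u≈ i)
    ; zero-closed = const 0# , λ i → sym (sum-ε +-commutativeMonoid {d} (λ j → zeroˡ (v j i)))
    ; +-closed = λ (x , u≈) (y , w≈) → (λ j → x j ⊕ y j) , λ i →
        trans (+-cong (u≈ i) (w≈ i)) (trans (sym (∑-distrib-+ (λ j → x j ⊗ v j i) _))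
          (sum-cong-≋ λ j → sym (distribʳ (v j i) (x j) (y j))))
    ; scale-closed = λ a (x , u≈) → (λ j → a ⊗ x j) , λ i →
        trans (*-congˡ (u≈ i)) (trans (*-distribˡ-sum a (λ j → x j ⊗ v j i))
          (sum-cong-≋ λ j → sym (*-assoc a (x j) (v j i))))
    }

  span-cong : ∀ {d} {v w : Fin d → Space K I} → (∀ j → SameEntries K (v j) (w j)) →
              ∀ {u} → Span K v u → Span K w u
  span-cong v≈w (x , u≈) = x , λ i → trans (u≈ i) (sum-cong-≋ λ j → *-congˡ (v≈w j i))

  combination-closed : ∀ {p} {V : Pred (Space K I) p} → IsSubspace K V →
                       ∀ {d} x {v : Fin d → Space K I} → (∀ j → v j ∈ V) → combination K x v ∈ V
  combination-closed V {zero}  x v∈V = IsSubspace.zero-closed V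
  combination-closed V {suc d} x v∈V = IsSubspace.+-closed V
    (IsSubspace.scale-closed V (x zero) (v∈V zero)) (combination-closed V (x ∘ suc) (v∈V ∘ suc))

module RestrictionOfScalars {c ℓ c′ ℓ′ q m} {K : FiniteField c ℓ q} {L : FiniteField c′ ℓ′ (q ℕ.^ m)}
                 (ι : Embedding K L) where
  private
    module K where
      open FieldProperties K public
      open SemiringSum semiring public
    module L where
      open FieldProperties L public
      open SemiringSum semiring public
  open Embedding ι
  open import Relation.Binary.Reasoning.Setoid L.≈-setoid

  φ-0 : φ K.0# L.≈ L.0#
  φ-0 = L.x+x≈x⇒x≈0 _ (L.trans (L.sym (φ-+ K.0# K.0#)) (φ-cong (K.+-identityʳ K.0#)))

  linear : ∀ {d} → (Fin d → K.Carrier) → (Fin d → L.Carrier) → L.Carrier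
  linear x b = L.sum (λ j → φ (x j) L.⊗ b j)

  linear-cong : ∀ {d} {x y : Fin d → K.Carrier} {b} → (∀ j → x j K.≈ y j) → linear x b L.≈ linear y b
  linear-cong x≈y = L.sum-cong-≋ λ j → L.*-congʳ (φ-cong (x≈y j))

  linear-+ : ∀ {d} x y (b : Fin d → L.Carrier) →
             linear (λ j → x j K.⊕ y j) b L.≈ linear x b L.⊕ linear y b
  linear-+ x y b = L.trans
    (L.sum-cong-≋ λ j → L.trans (L.*-congʳ (φ-+ (x j) (y j))) (L.distribʳ _ _ _))
    (L.∑-distrib-+ (λ j → φ (x j) L.⊗ b j) _)

  linear-scale : ∀ {d} a x (b : Fin d → L.Carrier) →
                 linear (λ j → a K.⊗ x j) b L.≈ φ a L.⊗ linear x b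
  linear-scale a x b = L.trans
    (L.sum-cong-≋ λ j → L.trans (L.*-congʳ (φ-* a (x j))) (L.*-assoc _ _ _))
    (L.sym (L.*-distribˡ-sum (φ a) (λ j → φ (x j) L.⊗ b j)))

  Independent : ∀ {d} → (Fin d → L.Carrier) → Set (c ⊔ ℓ ⊔ ℓ′)
  Independent b = ∀ x → linear x b L.≈ L.0# → ∀ j → x j K.≈ K.0#

  φ-neg : ∀ x → φ (K.- x) L.≈ L.- φ x
  φ-neg x = L.+-inverseʳ-unique _ _
    (L.trans (L.sym (φ-+ x (K.- x))) (L.trans (φ-cong (K.-‿inverseʳ x)) φ-0))

  independent⇒injective : ∀ {d} {b : Fin d → L.Carrier} → Independent b →
                          ∀ {x y} → linear x b L.≈ linear y b → ∀ j → x j K.≈ y j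
  independent⇒injective {b = b} b-indep {x} {y} eq j = K.x∙y⁻¹≈ε⇒x≈y _ _
    (b-indep (λ j → x j K.⊕ (K.- y j)) (begin
      linear (λ j → x j K.⊕ (K.- y j)) b                    ≈⟨ linear-+ x _ b ⟩
      linear x b L.⊕ linear (λ j → K.- y j) b               ≈⟨ L.+-congʳ eq ⟩
      linear y b L.⊕ linear (λ j → K.- y j) b               ≈⟨ linear-+ y _ b ⟨
      linear (λ j → y j K.⊕ (K.- y j)) b
        ≈⟨ sum-ε L.+-commutativeMonoid (λ j →
             L.trans (L.*-congʳ (L.trans (φ-cong (K.-‿inverseʳ (y j))) φ-0)) (L.zeroˡ (b j))) ⟩
      L.0#                                                  ∎) j)

  private
    combo : ∀ {d} → (Fin d → L.Carrier) → Fin (q ℕ.^ d) → L.Carrier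
    combo b t = linear (K.element ∘ finToFun t) b

    Hit : ∀ {d} → (Fin d → L.Carrier) → L.Carrier → Set ℓ′
    Hit b y = ∃[ t ] combo b t L.≈ y

    hit? : ∀ {d} (b : Fin d → L.Carrier) y → Dec (Hit b y)
    hit? b y = Fin.any? λ t → combo b t L.≟ y

    linear⇒hit : ∀ {d} {b : Fin d → L.Carrier} x {y} → linear x b L.≈ y → Hit b y
    linear⇒hit x eq = funToFin (K.index ∘ x) , L.trans (linear-cong λ j →
      K.trans (K.reflexive (≡.cong K.element (Fin.finToFun-funToFin (K.index ∘ x) j)))
        (K.element-index (x j))) eq

    -- `K^d` injects into `L`, so `q ^ d` is at most `q ^ m`.
    independent⇒≤ : ∀ {d} {b : Fin d → L.Carrier} → Independent b → d ℕ.≤ m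
    independent⇒≤ {d} {b} b-indep = ℕ.≮⇒≥ λ m<d → ℕ.<⇒≱ (ℕ.^-monoʳ-< q K.1<q m<d)
      (Fin.injective⇒≤ {f = L.index ∘ combo b} λ {s} {t} eq → finToFun-injective d λ i →
        K.element-injective (independent⇒injective b-indep (L.index-injective eq) i))

    -- A relation with nonzero coefficient at `y` can be solved for `y`, making it a combination of
    -- `b`.
    ∷-independent : ∀ {d} {b : Fin d → L.Carrier} → Independent b →
                    ∀ {y} → ¬ Hit b y → Independent (y Vector.∷ b)
    ∷-independent {b = b} b-indep {y} y∉b x xyb≈0 with x zero K.≟ K.0#
    ... | yes x₀≈0 = λ
      { zero    → x₀≈0
      ; (suc j) → b-indep (x ∘ suc) (L.trans (L.sym (L.+-identityˡ _))
          (L.trans (L.+-congʳ (L.sym (L.trans (L.*-congʳ (L.trans (φ-cong x₀≈0) φ-0)) (L.zeroˡ y))))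
            xyb≈0)) j }
    ... | no  x₀≉0 with K.∃-inverse x₀≉0
    ... | w , wx₀≈1 = contradiction (linear⇒hit (λ j → (K.- w) K.⊗ x (suc j)) (begin
      linear (λ j → (K.- w) K.⊗ x (suc j)) b
        ≈⟨ linear-scale _ _ b ⟩
      φ (K.- w) L.⊗ linear (x ∘ suc) b
        ≈⟨ L.trans (L.*-congʳ (φ-neg w)) (L.sym (L.-‿distribˡ-* _ _)) ⟩
      L.- (φ w L.⊗ linear (x ∘ suc) b)
        ≈⟨ L.-‿cong (L.*-congˡ (L.+-inverseʳ-unique _ _ xyb≈0)) ⟩
      L.- (φ w L.⊗ (L.- (φ (x zero) L.⊗ y)))
        ≈⟨ L.-‿cong (L.-‿distribʳ-* _ _) ⟨
      L.- (L.- (φ w L.⊗ (φ (x zero) L.⊗ y)))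
        ≈⟨ L.-‿involutive _ ⟩
      φ w L.⊗ (φ (x zero) L.⊗ y)
        ≈⟨ L.*-assoc _ _ _ ⟨
      (φ w L.⊗ φ (x zero)) L.⊗ y
        ≈⟨ L.*-congʳ (L.trans (L.sym (φ-* _ _)) (L.trans (φ-cong wx₀≈1) φ-1)) ⟩
      L.1# L.⊗ y
        ≈⟨ L.*-identityˡ y ⟩
      y  ∎)) y∉b

    -- For `d < m`, the `q ^ d` combinations of `b` cannot exhaust the `q ^ m` elements of `L`; an
    -- element they miss extends `b`.
    independent-family : ∀ d → d ℕ.≤ m → ∃[ b ] Independent {d} b
    independent-family zero    d≤m = (λ ()) , λ x _ ()
    independent-family (suc d) d<m with independent-family d (ℕ.<⇒≤ d<m)
    ... | b , b-indep with Fin.all? (λ i → hit? b (L.element i))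
    ... | no ¬hit = let (i , i∉b) = Fin.¬∀⟶∃¬ _ _ (λ i → hit? b (L.element i)) ¬hit in
      L.element i Vector.∷ b , ∷-independent b-indep i∉b
    ... | yes hit = contradiction
      (Fin.injective⇒≤ {f = proj₁ ∘ hit} λ {i} {j} eq → L.element-injective
        (L.trans (L.sym (proj₂ (hit i))) (L.trans (L.reflexive (≡.cong (combo b) eq)) (proj₂ (hit j)))))
      (ℕ.<⇒≱ (ℕ.^-monoʳ-< q K.1<q d<m))

  basis : Fin m → L.Carrier
  basis = proj₁ (independent-family m ℕ.≤-refl)

  basis-independent : Independent basis
  basis-independent = proj₂ (independent-family m ℕ.≤-refl)

  private
    basis-hit : ∀ y → Hit basis y
    basis-hit y with hit? basis y
    ... | yes hit = hit
    ... | no ¬hit = contradiction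
      (independent⇒≤ {b = y Vector.∷ basis} (∷-independent basis-independent ¬hit)) ℕ.1+n≰n

  coordinates : L.Carrier → Fin m → K.Carrier
  coordinates y = K.element ∘ finToFun (proj₁ (basis-hit y))

  linear-coordinates : ∀ y → linear (coordinates y) basis L.≈ y
  linear-coordinates y = proj₂ (basis-hit y)

  coordinates-unique : ∀ {x y} → linear x basis L.≈ y → ∀ s → coordinates y s K.≈ x s
  coordinates-unique eq = independent⇒injective basis-independent
    (L.trans (linear-coordinates _) (L.sym eq))

  coordinates-cong : ∀ {y z} → y L.≈ z → ∀ s → coordinates y s K.≈ coordinates z s
  coordinates-cong y≈z = coordinates-unique (L.trans (linear-coordinates _) (L.sym y≈z))

  coordinates-+ : ∀ y z s → coordinates (y L.⊕ z) s K.≈ coordinates y s K.⊕ coordinates z s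
  coordinates-+ y z = coordinates-unique (L.trans (linear-+ _ _ basis)
    (L.+-cong (linear-coordinates y) (linear-coordinates z)))

  coordinates-scale : ∀ x y s → coordinates (φ x L.⊗ y) s K.≈ x K.⊗ coordinates y s
  coordinates-scale x y = coordinates-unique (L.trans (linear-scale x _ basis)
    (L.*-congˡ (linear-coordinates y)))

  coordinates-zero : ∀ {y} → (∀ s → coordinates y s K.≈ K.0#) → y L.≈ L.0#
  coordinates-zero {y} y≈0 = L.trans (L.sym (linear-coordinates y))
    (sum-ε L.+-commutativeMonoid λ s →
      L.trans (L.*-congʳ (L.trans (φ-cong (y≈0 s)) φ-0)) (L.zeroˡ (basis s)))

  -- Used for two spaces: columns, where it governs the rank, and whole matrices, where it governs
  -- the dimension of the code.
  record LinearInjection (I J : Set) : Set (c ⊔ ℓ ⊔ c′ ⊔ ℓ′) where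
    field
      ρ         : Space L I → Space K J
      ρ-cong    : ∀ {u v} → SameEntries L u v → SameEntries K (ρ u) (ρ v)
      ρ-+       : ∀ u v → SameEntries K (ρ (λ i → u i L.⊕ v i)) (λ j → ρ u j K.⊕ ρ v j)
      ρ-scale   : ∀ x u → SameEntries K (ρ (λ i → φ x L.⊗ u i)) (λ j → x K.⊗ ρ u j)
      injective : ∀ {u} → IsZero K (ρ u) → IsZero L u

    ρ-zero : ∀ {u} → IsZero L u → IsZero K (ρ u)
    ρ-zero {u} u≈0 j = K.trans
      (ρ-cong (λ i → L.trans (u≈0 i) (L.sym (L.trans (L.*-congʳ φ-0) (L.zeroˡ (u i))))) j)
      (K.trans (ρ-scale K.0# u j) (K.zeroˡ _))

    ρ-sum : ∀ {d} (u : Fin d → Space L I) →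
            SameEntries K (ρ (λ i → L.sum (λ h → u h i))) (λ j → K.sum (λ h → ρ (u h) j))
    ρ-sum {zero}  u j = ρ-zero (λ i → L.refl) j
    ρ-sum {suc d} u j = K.trans (ρ-+ (u zero) _ j) (K.+-congˡ (ρ-sum (u ∘ suc) j))

    -- The products of the `basis` elements with the `v t`, as in the tower law for degrees, carried
    -- over to `K`.
    restrict : ∀ {r} → (Fin r → Space L I) → Fin (r ℕ.* m) → Space K J
    restrict {r} v h = ρ λ i → basis (remainder {r} m h) L.⊗ v (quotient {r} m h) i

    module _ {r} (v : Fin r → Space L I) where

      -- Grouping by `t` merges `m` scalars of `K` into one scalar of `L`.
      combination-restrict : ∀ x → SameEntries K (combination K x (restrict v))
        (ρ (combination L (λ t → linear (λ s → x (combine t s)) basis) v))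
      combination-restrict x j = K.trans
        (K.sum-cong-≋ λ h → K.sym (ρ-scale (x h) _ j))
        (K.trans (K.sym (ρ-sum (λ h i → φ (x h) L.⊗ (basis (rem h) L.⊗ v (quo h) i)) j))
        (ρ-cong (λ i → begin
          L.sum (λ h → term i (x h) (quo h) (rem h))
            ≈⟨ sum-combine L.+-commutativeMonoid r m _ ⟩
          L.sum {r} (λ t → L.sum {m} (λ s →
            term i (x (combine t s)) (quo (combine t s)) (rem (combine t s))))
            ≈⟨ L.sum-cong-≋ (λ t → L.sum-cong-≋ λ s → L.reflexive
                 (≡.cong (uncurry (term i (x (combine t s)))) (Fin.remQuot-combine t s))) ⟩
          L.sum (λ t → L.sum (λ s → term i (x (combine t s)) t s))
            ≈⟨ L.sum-cong-≋ (λ t → L.trans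
                 (L.sum-cong-≋ λ s → L.sym (L.*-assoc (φ (x (combine t s))) (basis s) (v t i)))
                 (L.sym (L.*-distribʳ-sum (v t i) (λ s → φ (x (combine t s)) L.⊗ basis s)))) ⟩
          L.sum (λ t → linear (λ s → x (combine t s)) basis L.⊗ v t i) ∎) j))
        where
        rem = remainder {r} m
        quo = quotient {r} m
        term : I → K.Carrier → Fin r → Fin m → L.Carrier
        term i x t s = φ x L.⊗ (basis s L.⊗ v t i)

      restrict-independent : LinearlyIndependent L v → LinearlyIndependent K (restrict v)
      restrict-independent v-indep x x≈0 h = K.trans
        (K.reflexive (≡.cong x (≡.sym (Fin.combine-remQuot {r} m h))))
        (basis-independent _ (v-indep _ (injective λ j →
          K.trans (K.sym (combination-restrict x j)) (x≈0 j)) _) _)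

      span-restrict⇒ : ∀ {N} → Span K (restrict v) N → ∃[ y ] SameEntries K N (ρ (combination L y v))
      span-restrict⇒ (x , N≈) = _ , λ j → K.trans (N≈ j) (combination-restrict x j)

      span-restrict⇐ : ∀ {u} → Span L v u → Span K (restrict v) (ρ u)
      span-restrict⇐ {u} (y , u≈) = x , λ j → K.trans
        (ρ-cong (λ i → L.trans (u≈ i) (L.sum-cong-≋ λ t → L.*-congʳ (L.sym (L.trans
          (L.sum-cong-≋ λ s → L.*-congʳ
            (L.reflexive (≡.cong (φ ∘ uncurry coeff) (Fin.remQuot-combine t s))))
          (linear-coordinates (y t)))))) j)
        (K.sym (combination-restrict x j))
        where
        coeff : Fin r → Fin m → K.Carrier
        coeff t = coordinates (y t)
        x : Fin (r ℕ.* m) → K.Carrier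
        x h = uncurry coeff (remQuot {r} m h)

    -- `W` is tied to `V` by two inclusions instead of being defined as an image, so it can be a
    -- column space or a span living in the universe of `K`.
    dimension-restrict : ∀ {p p′} {V : Pred (Space L I) p} {W : Pred (Space K J) p′} {r} →
      IsSubspace L V → (∀ {u} → u ∈ V → ρ u ∈ W) →
      (∀ {N} → N ∈ W → ∃[ u ] u ∈ V × SameEntries K N (ρ u)) →
      HasDimension L V r → HasDimension K W (m ℕ.* r)
    dimension-restrict {V = V} {W} {r} V-sub V⇒W W⇒V dim = ≡.subst (HasDimension K W) (ℕ.*-comm r m) record
      { basis       = restrict V.basis
      ; inside      = λ h → V⇒W (IsSubspace.scale-closed V-sub _ (V.inside _))
      ; independent = restrict-independent V.basis V.independent
      ; spanning    = λ N∈W → let (u , u∈V , N≈ρu) = W⇒V N∈W in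
          IsSubspace.respects (SpanProperties.span-subspace K (restrict V.basis)) (λ j → K.sym (N≈ρu j))
            (span-restrict⇐ V.basis (V.spanning u∈V))
      }
      where module V = HasDimension dim

  -- Expanding columns, matrices and codes.

  module _ {a : ℕ} where
    private
      -- `dilate` counts rows as `m * a`, while splitting into blocks expects `a * m`; hence the
      -- cast.
      block : Fin (m ℕ.* a) → Fin a
      block = quotient {a} m ∘ cast (ℕ.*-comm m a)

      offset : Fin (m ℕ.* a) → Fin m
      offset = remainder {a} m ∘ cast (ℕ.*-comm m a)

      row : Fin a → Fin m → Fin (m ℕ.* a)
      row i s = cast (ℕ.*-comm a m) (combine i s)

      remQuot-row : ∀ i s → (block (row i s) , offset (row i s)) ≡ (i , s)
      remQuot-row i s = ≡.trans
        (≡.cong (remQuot {a} m) (Fin.cast-involutive (ℕ.*-comm m a) (ℕ.*-comm a m) (combine i s)))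
        (Fin.remQuot-combine i s)

    expandColumn : LinearInjection (Fin a) (Fin (m ℕ.* a))
    expandColumn = record
      { ρ         = λ u i → coordinates (u (block i)) (offset i)
      ; ρ-cong    = λ u≈v i → coordinates-cong (u≈v _) _
      ; ρ-+       = λ u v i → coordinates-+ _ _ _
      ; ρ-scale   = λ x u i → coordinates-scale x _ _
      ; injective = λ {u} ρu≈0 i → coordinates-zero λ s → K.trans
          (K.reflexive (≡.cong (λ (i , s) → coordinates (u i) s) (≡.sym (remQuot-row i s))))
          (ρu≈0 (row i s))
      }

    module Column = LinearInjection expandColumn

    module _ {n : ℕ} where

      column : Matrix L a n → Fin n → Space L (Fin a)
      column M j i = M (i , j)

      -- Column `combine j s` lists the coordinates of `basis s` times column `j`, so each block is
      -- a multiplication matrix. Written with `Column.restrict`, it brings the column space under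
      -- `Column.dimension-restrict`.
      expand : LinearInjection (Fin a × Fin n) (Fin (m ℕ.* a) × Fin (n ℕ.* m))
      expand = record
        { ρ         = λ M (i , j) → Column.restrict (column M) j i
        ; ρ-cong    = λ {M} {N} M≈N (i , j) →
            Column.ρ-cong {term M j} {term N j} (λ i → L.*-congˡ (M≈N (i , _))) i
        ; ρ-+       = λ M N (i , j) → K.trans
            (Column.ρ-cong {v = λ i → term M j i L.⊕ term N j i} (λ i → L.distribˡ _ _ _) i)
            (Column.ρ-+ (term M j) (term N j) i)
        ; ρ-scale   = λ x M (i , j) → K.trans
            (Column.ρ-cong {v = λ i → φ x L.⊗ term M j i} (λ i → x∙yz≈y∙xz _ _ _) i)
            (Column.ρ-scale x (term M j) i)
        ; injective = λ {M} ρM≈0 (i , j) →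
            let basis-M≈0 : ∀ s → basis s L.⊗ M (i , j) L.≈ L.0#
                basis-M≈0 s = L.trans
                  (L.reflexive (≡.cong (λ (j , s) → basis s L.⊗ M (i , j))
                    (≡.sym (Fin.remQuot-combine j s))))
                  (Column.injective {term M (combine j s)} (λ i → ρM≈0 (i , combine j s)) i)
            in begin
            M (i , j)
              ≈⟨ L.*-identityˡ _ ⟨
            L.1# L.⊗ M (i , j)
              -- Expanding 1 in `basis` writes the entry as a combination of its products with the
              -- `basis s`, all of which are zero.
              ≈⟨ L.*-congʳ (linear-coordinates L.1#) ⟨
            linear (coordinates L.1#) basis L.⊗ M (i , j)
              ≈⟨ L.*-distribʳ-sum (M (i , j)) (λ s → φ (coordinates L.1# s) L.⊗ basis s) ⟩
            L.sum (λ s → (φ (coordinates L.1# s) L.⊗ basis s) L.⊗ M (i , j))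
              ≈⟨ sum-ε L.+-commutativeMonoid (λ s →
                   L.trans (L.*-assoc _ _ _) (L.trans (L.*-congˡ (basis-M≈0 s)) (L.zeroʳ _))) ⟩
            L.0#  ∎
        }
        where
        open CommutativeSemigroupProperties L.*-commutativeSemigroup using (x∙yz≈y∙xz)
        term : Matrix L a n → Fin (n ℕ.* m) → Space L (Fin a)
        term M j i = basis (remainder {n} m j) L.⊗ M (i , quotient {n} m j)

      module Expand = LinearInjection expand

      -- Stated up to `SameEntries`, since words of the expanded code are known only up to equal
      -- entries.
      rank-expand : ∀ {M N r} → SameEntries K N (Expand.ρ M) → HasRank L M r → HasRank K N (m ℕ.* r)
      rank-expand {M} N≈ρM = Column.dimension-restrict
        (SpanProperties.span-subspace L (column M))
        (λ u∈M → SpanProperties.span-cong K (λ j i → K.sym (N≈ρM (i , j)))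
          (Column.span-restrict⇐ (column M) u∈M))
        (λ w∈N → let (y , w≈) = Column.span-restrict⇒ (column M)
                                  (SpanProperties.span-cong K (λ j i → N≈ρM (i , j)) w∈N) in
          _ , (y , λ i → L.refl) , w≈)

      module _ .{{_ : NonZero m}} {F : FerrersDiagram a n} {k δ : ℕ} {C : Pred (Matrix L a n) (c′ ⊔ ℓ′)}
               (code : IsFerrersCode L F k δ C) where
        open IsFerrersCode code
        open HasDimension dimension using (inside; spanning) renaming (basis to codeBasis)
        open HasMinimumDistance minimumDistance

        -- Spanned by the expanded basis rather than defined as the image of C, which
        -- would live in the universe of L.
        expandedCode : Pred (Matrix K (m ℕ.* a) (n ℕ.* m)) (c ⊔ ℓ)
        expandedCode = Span K (Expand.restrict codeBasis)

        C⇒expanded : ∀ {M} → M ∈ C → Expand.ρ M ∈ expandedCode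
        C⇒expanded M∈C = Expand.span-restrict⇐ codeBasis (spanning M∈C)

        expanded⇒C : ∀ {N} → N ∈ expandedCode → ∃[ M ] M ∈ C × SameEntries K N (Expand.ρ M)
        expanded⇒C N∈C′ = let (y , N≈) = Expand.span-restrict⇒ codeBasis N∈C′ in
          _ , SpanProperties.combination-closed L isSubspace y inside , N≈

        expandedCode-isFerrersCode : IsFerrersCode K (dilate m F) (m ℕ.* k) (m ℕ.* δ) expandedCode
        expandedCode-isFerrersCode = record
          { isSubspace = SpanProperties.span-subspace K (Expand.restrict codeBasis)
          ; dimension = Expand.dimension-restrict isSubspace C⇒expanded expanded⇒C dimension
          ; minimumDistance = record
            { attained = let (M , M∈C , M≉0 , rank) = attained in
                Expand.ρ M , C⇒expanded M∈C , M≉0 ∘ Expand.injective , rank-expand (λ _ → K.refl) rank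
            -- A nonzero word of the expanded code comes from a nonzero word of `C`, because `ρ`
            -- sends zero to zero.
            ; bound = λ N∈C′ N≉0 →
                let (M , M∈C , N≈ρM) = expanded⇒C N∈C′
                    (r , rank , δ≤r) = bound M∈C λ M≈0 →
                      N≉0 λ i → K.trans (N≈ρM i) (Expand.ρ-zero M≈0 i)
                in m ℕ.* r , rank-expand N≈ρM rank , ℕ.*-monoʳ-≤ m δ≤r
            }
          ; support = λ N∈C′ i j mγ≤i → let (M , M∈C , N≈ρM) = expanded⇒C N∈C′ in
              K.trans (N≈ρM (i , j)) (K.trans
                -- The entry is a coordinate of some `basis s` times an entry outside `F`, hence a
                -- coordinate of zero.
                (coordinates-cong (L.trans
                  (L.*-congˡ (support M∈C (block i) (quotient {n} m j)
                    (m*g≤toℕ⇒g≤quotient m (cast (ℕ.*-comm m a) i)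
                    (≡.subst (_ ℕ.≤_) (≡.sym (Fin.toℕ-cast (ℕ.*-comm m a) i)) mγ≤i))))
                  (L.zeroʳ _)) _)
                (Column.ρ-zero (λ _ → L.refl) i))
          }

open import Data.Nat.Base using (_*_; _^_)

theorem3p3 : ∀ {c ℓ c′ ℓ′} (q m : ℕ) .{{_ : NonZero m}} → IsPrimePower q →
    (K : FiniteField c ℓ q) (L : FiniteField c′ ℓ′ (q ^ m)) →
    ∀ {a n} (F : FerrersDiagram a n) (k δ : ℕ) →
    FerrersCode L F k δ →
    FerrersCode K (dilate m F) (m * k) (m * δ)
theorem3p3 q m q-pp K L F k δ (C , code) = expandedCode code , expandedCode-isFerrersCode code
  where open RestrictionOfScalars {m = m} (EmbeddingExistence.embedding {m = m} q-pp K L)
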